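{- For every $\alpha\in(0,1)$, every randomized online algorithm for non-clairvoyant dynamic bin packing whose expected total migrated size is at most an $\alpha$-fraction of the total size of the items has competitive ratio at least $\frac14\left\lfloor\frac{1}{4\alpha}\right\rfloor$.
   Context: Dynamic bin packing: bins have capacity $1$; items arrive online at times $a_i\ge0$ with size $s_i\in[0,1]$ and duration $d_i>0$ (only the size is revealed at arrival), present during $[a_i,a_i+d_i)$. Each item is placed on arrival into an open bin with enough remaining capacity or a new bin; a migration moves an already placed item to another bin. In the size-cost model each migration of item $i$ costs $s_i$; the total size of the items is $\sum_i s_i$. Cost = total active time $\int_0^\infty(\text{number of nonempty bins at } t)\,dt$; $\mathrm{OPT}(I)=\int_0^\infty\mathrm{OPT}_t\,dt$ with $\mathrm{OPT}_t$ the minimum number of unit bins to pack the items present at time $t$. Competitive ratio at least $\gamma$: for every $\beta<\gamma$ some instance has expected cost $>\beta\,\mathrm{OPT}$. -}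

module Defs where

open import Level using (0ℓ)
open import Algebra.Bundles using (CommutativeRing)
open import Algebra.Structures using (IsCommutativeRing)
import Algebra.Definitions.RawMonoid as RawMonoidDefs
open import Data.Bool.Base using (Bool; if_then_else_; _∧_)
open import Data.Fin.Base as Fin using (Fin; toℕ)
open import Data.List.Base as List using (List; length; filter; take; allFin; catMaybes; deduplicate)
open import Data.List.Membership.Propositional using (_∈_)
open import Data.List.Relation.Unary.Unique.Propositional using (Unique)
open import Data.Maybe.Base using (Maybe; just; nothing)
open import Data.Maybe.Properties using (≡-dec)
open import Data.Nat.Base as ℕ using (ℕ; zero; suc)
import Data.Nat.Properties as ℕₚ
open import Data.Product.Base using (Σ-syntax; ∃; ∃-syntax; _×_; _,_; proj₁)
open import Relation.Binary.Core using (Rel)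
open import Relation.Binary.Definitions using (Decidable)
open import Relation.Binary.PropositionalEquality using (_≡_; _≢_)
open import Relation.Binary.Structures using (IsDecTotalOrder)
import Relation.Binary.Construct.NonStrictToStrict as Strict
open import Relation.Nullary.Decidable.Core using (does; _×-dec_)
open import Relation.Unary using (Pred; U; ∁; _≐_; ⋃; Satisfiable)

------------------------------------------------------------------------
-- Real numbers

IsUpperBound : {A : Set} → Rel A 0ℓ → Pred A 0ℓ → Pred A 0ℓ
IsUpperBound _≤_ S u = ∀ x → S x → x ≤ u

IsSupremum : {A : Set} → Rel A 0ℓ → Pred A 0ℓ → Pred A 0ℓ
IsSupremum _≤_ S s = IsUpperBound _≤_ S s × (∀ u → IsUpperBound _≤_ S u → s ≤ u)

-- Dedekind-complete ordered fields; classically there is exactly one up to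
-- isomorphism.  Classically `archimedean` follows from `complete`; it is a
-- field of the record because that derivation is not constructive.
record RealNumbers : Set₁ where
  infix  8 _⁻¹ -_
  infixl 7 _*_
  infixl 6 _+_ _-_
  infix  4 _≤_
  field
    ℝ       : Set
    _+_ _*_ : ℝ → ℝ → ℝ
    -_      : ℝ → ℝ
    0# 1#   : ℝ
    _⁻¹     : ℝ → ℝ          -- arbitrary at 0#
    _≤_     : Rel ℝ 0ℓ
    isCommutativeRing : IsCommutativeRing _≡_ _+_ _*_ -_ 0# 1#
    0≢1               : 0# ≢ 1#
    *-inverseʳ        : ∀ x → x ≢ 0# → x * x ⁻¹ ≡ 1#
    isDecTotalOrder   : IsDecTotalOrder _≡_ _≤_
    +-monoˡ-≤         : ∀ z {x y} → x ≤ y → x + z ≤ y + z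
    *-nonneg          : ∀ {x y} → 0# ≤ x → 0# ≤ y → 0# ≤ x * y

  commutativeRing : CommutativeRing 0ℓ 0ℓ
  commutativeRing = record { isCommutativeRing = isCommutativeRing }

  open CommutativeRing commutativeRing public using (+-rawMonoid)
  open IsDecTotalOrder isDecTotalOrder public using (_≤?_; _≟_)
  open Strict _≡_ _≤_ public using (_<_)
  open RawMonoidDefs +-rawMonoid public using (sum) renaming (_×_ to _·_)

  _<?_ : Decidable _<_
  _<?_ = Strict.<-decidable _≡_ _≤_ _≟_ _≤?_

  _-_ : ℝ → ℝ → ℝ
  x - y = x + (- y)

  fromℕ : ℕ → ℝ
  fromℕ n = n · 1#

  field
    archimedean : ∀ x → ∃[ n ] x < fromℕ n
    complete    : (S : Pred ℝ 0ℓ) → Satisfiable S → Satisfiable (IsUpperBound _≤_ S) →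
                  Satisfiable (IsSupremum _≤_ S)

  searchDown : ℝ → ℕ → ℕ
  searchDown x zero    = zero
  searchDown x (suc n) = if does (fromℕ (suc n) ≤? x) then suc n else searchDown x n

  -- The integer part of x when 0# ≤ x.
  ⌊_⌋ : ℝ → ℕ
  ⌊ x ⌋ = searchDown x (proj₁ (archimedean x))

module BinPacking (R : RealNumbers) where
  open RealNumbers R

  ----------------------------------------------------------------------
  -- Integrals over [t, ∞) of eventually vanishing, right-continuous step
  -- functions

  data StepFunction (f : ℝ → ℕ) (t : ℝ) : Set where
    vanish : (∀ u → t ≤ u → f u ≡ 0) → StepFunction f t
    piece  : ∀ t′ → t < t′ → (∀ u → t ≤ u → u < t′ → f u ≡ f t) →
             StepFunction f t′ → StepFunction f t

  ∫ : ∀ {f t} → StepFunction f t → ℝ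
  ∫ (vanish _)                   = 0#
  ∫ {f} {t} (piece t′ _ _ rest) = fromℕ (f t) * (t′ - t) + ∫ rest

  ----------------------------------------------------------------------
  -- Probability

  record ProbabilitySpace : Set₁ where
    field
      Ω          : Set
      Measurable : Pred Ω 0ℓ → Set
      measurable-resp : ∀ {A B} → A ≐ B → Measurable A → Measurable B
      measurable-U    : Measurable U
      measurable-∁    : ∀ {A} → Measurable A → Measurable (∁ A)
      measurable-⋃    : {A : ℕ → Pred Ω 0ℓ} → (∀ n → Measurable (A n)) → Measurable (⋃ ℕ A)
      P      : ∀ {A} → Measurable A → ℝ
      P-cong : ∀ {A B} → A ≐ B → (a : Measurable A) (b : Measurable B) → P a ≡ P b
      P-nonneg : ∀ {A} (a : Measurable A) → 0# ≤ P a
      P-U      : P measurable-U ≡ 1#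
      -- A series of nonnegative terms is the supremum of its partial sums.
      P-σ-additive : {A : ℕ → Pred Ω 0ℓ} (a : ∀ n → Measurable (A n)) →
        (∀ {m n ω} → A m ω → A n ω → m ≡ n) →
        IsSupremum _≤_ (λ x → ∃[ n ] x ≡ sum {n} (λ i → P (a (toℕ i)))) (P (measurable-⋃ a))

    IsRandomVariable : (Ω → ℝ) → Set
    IsRandomVariable X = ∀ c → Measurable (λ ω → X ω ≤ c)

    record SimpleFunction : Set where
      field
        fun       : Ω → ℝ
        nonneg    : ∀ ω → 0# ≤ fun ω
        values    : List ℝ
        distinct  : Unique values
        range     : ∀ ω → fun ω ∈ values
        level     : ∀ v → Measurable (λ ω → fun ω ≡ v)

      simpleIntegral : ℝ
      simpleIntegral = List.foldr (λ v acc → v * P (level v) + acc) 0# values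

    open SimpleFunction

    -- The Lebesgue integral of a nonnegative random variable X exists in ℝ
    -- and equals e.
    HasExpectation : (Ω → ℝ) → ℝ → Set
    HasExpectation X e =
      IsSupremum _≤_
        (λ x → Σ[ φ ∈ SimpleFunction ] (∀ ω → fun φ ω ≤ X ω) × x ≡ simpleIntegral φ) e

  ----------------------------------------------------------------------
  -- Instances

  record Item : Set where
    field
      arrival size duration : ℝ
      0≤arrival  : 0# ≤ arrival
      0≤size     : 0# ≤ size
      size≤1     : size ≤ 1#
      0<duration : 0# < duration

    departure : ℝ
    departure = arrival + duration

    Present : ℝ → Set
    Present t = arrival ≤ t × t < departure

    present? : ∀ t → Bool
    present? t = does ((arrival ≤? t) ×-dec (t <? departure))

  open Item

  -- Items are indexed in the order in which they are revealed; items with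
  -- the same arrival time are still revealed one after the other.
  record Instance : Set where
    field
      #items : ℕ
      item   : Fin #items → Item
      sorted : ∀ i j → i Fin.≤ j → arrival (item i) ≤ arrival (item j)

    totalSize : ℝ
    totalSize = sum (λ i → size (item i))

    -- A configuration records the bin (a label in ℕ) of each item that is
    -- currently in a bin.
    Configuration : Set
    Configuration = Fin #items → Maybe ℕ

    load : Configuration → ℕ → ℝ
    load c b = sum (λ i → if does (≡-dec ℕₚ._≟_ (c i) (just b)) then size (item i) else 0#)

    WithinCapacity : Configuration → Set
    WithinCapacity c = ∀ b → load c b ≤ 1#

    nonemptyBins : Configuration → ℕ
    nonemptyBins c = length (deduplicate ℕₚ._≟_ (catMaybes (List.tabulate c)))

  open Instance

  ----------------------------------------------------------------------
  -- The optimum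

  IsPackingAt : (I : Instance) → ℝ → Configuration I → Set
  IsPackingAt I t c = (∀ i → Present (item I i) t → ∃[ b ] c i ≡ just b)
                    × (∀ i b → c i ≡ just b → Present (item I i) t)
                    × WithinCapacity I c

  IsOPTAt : Instance → ℝ → ℕ → Set
  IsOPTAt I t m = (∃[ c ] IsPackingAt I t c × nonemptyBins I c ≡ m)
                × (∀ c → IsPackingAt I t c → m ℕ.≤ nonemptyBins I c)

  IsOPT : Instance → ℝ → Set
  IsOPT I v = Σ[ opt ∈ (ℝ → ℕ) ] (∀ t → 0# ≤ t → IsOPTAt I t (opt t))
            × Σ[ s ∈ StepFunction opt 0# ] v ≡ ∫ s

  ----------------------------------------------------------------------
  -- Deterministic non-clairvoyant online algorithms

  -- What has been observed of a revealed item: a departure time is known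
  -- only once the item has departed.
  record Observation : Set where
    constructor observation
    field
      arrivalTime : ℝ
      itemSize    : ℝ
      departed    : Maybe ℝ

  record History : Set where
    constructor history
    field
      now  : ℝ
      seen : List Observation

  observe : ℝ → Item → Observation
  observe t x = observation (arrival x) (size x)
    (if does (departure x ≤? t) then just (departure x) else nothing)

  -- The history at time t when exactly the first j items have been revealed.
  historyAt : Instance → ℕ → ℝ → History
  historyAt I j t = history t (take j (List.tabulate (λ i → observe t (item I i))))

  -- The bin in which each item (given by its index) currently is, as a
  -- function of everything observed so far.  A history determines all
  -- earlier histories, hence also the algorithm's own past decisions.
  Strategy : Set
  Strategy = History → ℕ → ℕ

  -- With j items revealed, the current time can be t.  When several items
  -- arrive at t, or just before an item arriving at t is revealed, this
  -- holds for more than one j.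
  Reachable : Instance → ℕ → ℝ → Set
  Reachable I j t = j ℕ.≤ #items I × 0# ≤ t
                  × (∀ i → toℕ i ℕ.< j → arrival (item I i) ≤ t)
                  × (∀ i → j ℕ.≤ toℕ i → t ≤ arrival (item I i))

  configuration : Strategy → (I : Instance) → ℕ → ℝ → Configuration I
  configuration σ I j t i =
    if does (toℕ i ℕₚ.<? j) ∧ present? (item I i) t
      then just (σ (historyAt I j t) (toℕ i)) else nothing

  IsFeasible : Strategy → Set
  IsFeasible σ = ∀ I j t → Reachable I j t → WithinCapacity I (configuration σ I j t)

  moved : Maybe ℕ → Maybe ℕ → ℝ → ℝ
  moved (just b) (just b′) s = if does (b ℕₚ.≟ b′) then 0# else s
  moved _        _         s = 0#

  -- Total size of the items that are in a bin in both configurations, but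
  -- not in the same one.
  movedSize : (I : Instance) → Configuration I → Configuration I → ℝ
  movedSize I c c′ = sum (λ i → moved (c i) (c′ i) (size (item I i)))

  -- The trajectory of configurations from the moment (j, t) until all items
  -- have departed, with finitely many changes.  Changes occur at the end of
  -- a `wait` (because of a departure, or at a time the algorithm chose) and
  -- at the revelation of an item, in an `arrive`.
  data Execution (σ : Strategy) (I : Instance) (j : ℕ) (t : ℝ) : Set where
    done   : j ≡ #items I → (∀ i → departure (item I i) ≤ t) → Execution σ I j t
    wait   : ∀ t′ → t < t′ → Reachable I j t′ →
             (∀ u → t ≤ u → u < t′ → ∀ i → configuration σ I j u i ≡ configuration σ I j t i) →
             Execution σ I j t′ → Execution σ I j t
    arrive : Reachable I (suc j) t → Execution σ I (suc j) t → Execution σ I j t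

  migratedSize : ∀ {σ I j t} → Execution σ I j t → ℝ
  migratedSize (done _ _) = 0#
  migratedSize {σ} {I} {j} {t} (wait t′ _ _ _ rest) =
    movedSize I (configuration σ I j t) (configuration σ I j t′) + migratedSize rest
  migratedSize {σ} {I} {j} {t} (arrive _ rest) =
    movedSize I (configuration σ I j t) (configuration σ I (suc j) t) + migratedSize rest

  #arrived : Instance → ℝ → ℕ
  #arrived I t = length (filter (λ i → arrival (item I i) ≤? t) (allFin (#items I)))

  activeBins : Strategy → Instance → ℝ → ℕ
  activeBins σ I t = nonemptyBins I (configuration σ I (#arrived I t) t)

  ----------------------------------------------------------------------
  -- Randomized algorithms

  record RandomizedAlgorithm : Set₁ where
    field
      space : ProbabilitySpace

    open ProbabilitySpace space public

    field
      strategy  : Ω → Strategy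
      feasible  : ∀ ω → IsFeasible (strategy ω)
      execution : ∀ ω I → Execution (strategy ω) I 0 0#
      active    : ∀ ω I → StepFunction (activeBins (strategy ω) I) 0#

    migrated : Instance → Ω → ℝ
    migrated I ω = migratedSize (execution ω I)

    cost : Instance → Ω → ℝ
    cost I ω = ∫ (active ω I)

    field
      migrated-measurable : ∀ I → IsRandomVariable (migrated I)
      cost-measurable     : ∀ I → IsRandomVariable (cost I)

  ExpectedMigrationAtMost : ℝ → RandomizedAlgorithm → Set
  ExpectedMigrationAtMost α A =
    ∀ I → ∃[ e ] HasExpectation (migrated I) e × e ≤ α * totalSize I
    where open RandomizedAlgorithm A

  CompetitiveRatioAtLeast : ℝ → RandomizedAlgorithm → Set
  CompetitiveRatioAtLeast γ A =
    ∀ β → β < γ → ∃[ I ] ∃[ opt ] ∃[ e ] IsOPT I opt × HasExpectation (cost I) e × β * opt < e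
    where open RandomizedAlgorithm A

{-# OPTIONS --safe #-}
module Submission where

-- Let k = ⌊1 / 4α⌋.  At time 0 the adversary releases k² items of size 1/k.
-- It draws k of them independently, with replacement; the drawn items live
-- until time 1 + k², all others until time 1, so OPT = k + k².
--
-- The placement at time 0 cannot depend on the draw, and a bin holds at most
-- k items, so two drawn items share a bin with probability at most 1/k: on
-- average the drawn items occupy at least k - k (k - 1) / 2k = (k + 1) / 2
-- bins.  Migrating them costs 1/k each, hence at all times before 1 + k² the
-- number of nonempty bins is at least this number minus k times the migrated
-- size.  The latter has expectation at most α k ≤ 1/4, so the expected cost
-- averaged over all draws is at least (1 + k²) (k + 2) / 4 > (k / 4) OPT, and
-- some draw attains the average.

open import Defs

open import Algebra.Bundles using (CommutativeRing)
import Algebra.Properties.CommutativeMonoid.Sum as CommutativeMonoidSum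
import Algebra.Properties.Monoid.Mult as MonoidMult
import Algebra.Properties.Ring as RingProperties
import Algebra.Properties.Semiring.Mult as SemiringMult
import Algebra.Solver.Ring.NaturalCoefficients.Default as SemiringSolver
open import Data.Bool.Base using (true; false; if_then_else_)
open import Data.Fin.Base as Fin using (Fin; toℕ; fromℕ<)
import Data.Fin.Properties as Finₚ
open import Data.List.Base as List using (List; []; _∷_; _++_; length; filter; map; foldr; concatMap; take; allFin; upTo; catMaybes; deduplicate)
import Data.List.Membership.DecPropositional as DecMembership
open import Data.List.Membership.Propositional using (_∈_; _∉_)
open import Data.List.Membership.Propositional.Properties
open import Data.List.Properties using (length-++; length-map; length-upTo; length-tabulate; length-deduplicate; length-catMaybes; map-++; map-cong; tabulate-cong; filter-all; filter-some)
open import Data.List.Relation.Binary.Subset.Propositional using (_⊆_)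
open import Data.List.Relation.Unary.All as All using (All; []; _∷_)
open import Data.List.Relation.Unary.All.Properties using (¬Any⇒All¬)
open import Data.List.Relation.Unary.AllPairs using ([]; _∷_)
open import Data.List.Relation.Unary.Any using (here; there)
import Data.List.Relation.Unary.Unique.DecPropositional.Properties as DecUniqueₚ
open import Data.List.Relation.Unary.Unique.Propositional using (Unique)
import Data.List.Relation.Unary.Unique.Propositional.Properties as Uniqueₚ
open import Data.Maybe.Base using (Maybe; just; nothing)
open import Data.Maybe.Properties using (≡-dec; just-injective)
open import Data.Nat.Base as ℕ using (ℕ; zero; suc; NonZero)
open import Data.Nat.DivMod using (_/_; m≡m%n+[m/n]*n; m%n<n; m<n*o⇒m/o<n)
open import Data.Nat.ListAction using () renaming (sum to sumℕ)
open import Data.Nat.ListAction.Properties using (sum-++)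
import Data.Nat.Properties as ℕₚ
open import Data.Nat.Solver using (module +-*-Solver)
open import Data.Product.Base using (Σ-syntax; ∃-syntax; _×_; _,_; proj₁; proj₂)
open import Data.Sum.Base using (_⊎_; inj₁; inj₂)
open import Data.Unit.Base using (tt)
open import Data.Vec.Base using (Vec; []; _∷_; toList)
import Data.Vec.Properties as Vecₚ
open import Function.Base using (_∘_; id)
open import Level using (0ℓ)
open import Relation.Binary.Bundles using (Poset)
import Relation.Binary.Construct.NonStrictToStrict as Strict
open import Relation.Binary.PropositionalEquality
import Relation.Binary.Reasoning.PartialOrder as PartialOrderReasoning
open import Relation.Binary.Structures using (IsDecTotalOrder)
open import Relation.Nullary using (¬_; Dec; does; yes; no; contradiction; ¬?)
open import Relation.Nullary.Decidable using (_×-dec_; _⊎-dec_; decidable-stable)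
open import Relation.Unary using (Pred; Decidable; U; ∁; _∩_; _∪_; _≐_; ⋃)

-- The draw stays outside the probability space: it is averaged by a finite sum over all `k`-tuples
-- of items, and for each fixed outcome of the algorithm that sum is bounded below by one constant.
-- Drawing with replacement turns the tuples into a product, so collisions can be counted one draw
-- at a time; an item drawn twice is just one more collision, already included in the at most `k`
-- items of its bin. The obstacle is the expectation, which is only a supremum over simple
-- functions. The argument needs that a constant below a weighted sum of costs and migrated sizes is
-- also below the weighted sum of their expectations. The supremum readily yields the opposite
-- inequality, that the expectation of a sum is at least the sum of the expectations. The required
-- direction rests on measurability: each variable is approximated from below by simple functions
-- with error `δ`, and these are integrated as finite sums of weighted events. The survivors live so
-- long because the optimum also pays for `k` bins at first; this must become a lower-order term,
-- small enough to be absorbed by the difference between `k + 2` and `k`.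

module Counting where
  open import Data.Nat.Base
  open DecMembership ℕₚ._≟_ using (_∈?_)

  private variable
    A B : Set

  -- Counting distinct entries of lists

  unique-⊆⇒length≤ : {xs ys : List A} → Unique xs → xs ⊆ ys → length xs ≤ length ys
  unique-⊆⇒length≤ [] _ = z≤n
  unique-⊆⇒length≤ {xs = x ∷ xs} u@(_ ∷ uxs) xs⊆ys with ∈-∃++ (xs⊆ys (here refl))
  ... | ys₁ , ys₂ , refl = begin
    suc (length xs)                    ≤⟨ s≤s (unique-⊆⇒length≤ uxs xs⊆rest) ⟩
    suc (length (ys₁ ++ ys₂))          ≡⟨ cong suc (length-++ ys₁) ⟩
    suc (length ys₁ + length ys₂)      ≡⟨ ℕₚ.+-suc (length ys₁) (length ys₂) ⟨
    length ys₁ + length (x ∷ ys₂)      ≡⟨ length-++ ys₁ ⟨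
    length (ys₁ ++ x ∷ ys₂)            ∎
    where
    open ℕₚ.≤-Reasoning
    xs⊆rest : xs ⊆ ys₁ ++ ys₂
    xs⊆rest z∈xs with ∈-++⁻ ys₁ (xs⊆ys (there z∈xs))
    ... | inj₁ z∈ys₁         = ∈-++⁺ˡ z∈ys₁
    ... | inj₂ (here refl)   = contradiction z∈xs (Uniqueₚ.Unique[x∷xs]⇒x∉xs u)
    ... | inj₂ (there z∈ys₂) = ∈-++⁺ʳ ys₁ z∈ys₂

  #distinct : List ℕ → ℕ
  #distinct xs = length (deduplicate ℕₚ._≟_ xs)

  -- Here `zs` is charged with its full length. In the main application it lists the initial bins of
  -- the survivors that have moved, one entry per moved survivor, and `ys` the bins in use now.
  #distinct-⊆-++ : ∀ {xs} zs ys → xs ⊆ zs ++ ys → #distinct xs ≤ length zs + #distinct ys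
  #distinct-⊆-++ {xs} zs ys xs⊆zs++ys =
    subst (#distinct xs ≤_) (length-++ zs) (unique-⊆⇒length≤ (DecUniqueₚ.deduplicate-! ℕₚ._≟_ xs) dedup⊆)
    where
    dedup⊆ : deduplicate ℕₚ._≟_ xs ⊆ zs ++ deduplicate ℕₚ._≟_ ys
    dedup⊆ z∈ with ∈-++⁻ zs (xs⊆zs++ys (∈-deduplicate⁻ ℕₚ._≟_ xs z∈))
    ... | inj₁ z∈zs = ∈-++⁺ˡ z∈zs
    ... | inj₂ z∈ys = ∈-++⁺ʳ zs (∈-deduplicate⁺ ℕₚ._≟_ z∈ys)

  #distinct-⊆ : ∀ {xs ys} → xs ⊆ ys → #distinct xs ≤ length ys
  #distinct-⊆ {xs} xs⊆ys = unique-⊆⇒length≤ (DecUniqueₚ.deduplicate-! ℕₚ._≟_ xs)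
    (λ z∈ → xs⊆ys (∈-deduplicate⁻ ℕₚ._≟_ xs z∈))

  occurrences : ℕ → List ℕ → ℕ
  occurrences b bs = length (filter (b ℕₚ.≟_) bs)

  ∈⇒1≤occurrences : ∀ {b bs} → b ∈ bs → 1 ≤ occurrences b bs
  ∈⇒1≤occurrences {b} = filter-some (b ℕₚ.≟_)

  -- If `b` is new, one distinct entry is gained; otherwise `occurrences b bs` is at least 1. The
  -- indicator of a collision is thus replaced by a count that is additive in `bs` and can be summed
  -- over a random `b`: a union bound.
  #distinct-∷ : ∀ b bs → 1 + #distinct bs ≤ #distinct (b ∷ bs) + occurrences b bs
  #distinct-∷ b bs with b ∈? bs
  ... | yes b∈bs = begin
    1 + #distinct bs                        ≡⟨ ℕₚ.+-comm 1 _ ⟩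
    #distinct bs + 1                        ≤⟨ ℕₚ.+-mono-≤ (#distinct-⊆-++ [] (b ∷ bs) there) (∈⇒1≤occurrences b∈bs) ⟩
    #distinct (b ∷ bs) + occurrences b bs   ∎
    where open ℕₚ.≤-Reasoning
  ... | no  b∉bs = ℕₚ.≤-trans (unique-⊆⇒length≤ (¬Any⇒All¬ _ b∉dedup ∷ DecUniqueₚ.deduplicate-! ℕₚ._≟_ bs) ⊆dedup) (ℕₚ.m≤m+n _ _)
    where
    b∉dedup : b ∉ deduplicate ℕₚ._≟_ bs
    b∉dedup = b∉bs ∘ ∈-deduplicate⁻ ℕₚ._≟_ bs
    ⊆dedup : b ∷ deduplicate ℕₚ._≟_ bs ⊆ deduplicate ℕₚ._≟_ (b ∷ bs)
    ⊆dedup (here refl) = here refl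
    ⊆dedup (there z∈)  = ∈-deduplicate⁺ ℕₚ._≟_ (there (∈-deduplicate⁻ ℕₚ._≟_ bs z∈))

  ∈-catMaybes⁺ : ∀ {x : A} {xs} → just x ∈ xs → x ∈ catMaybes xs
  ∈-catMaybes⁺ {xs = just _  ∷ _} (here refl) = here refl
  ∈-catMaybes⁺ {xs = just _  ∷ _} (there x∈)  = there (∈-catMaybes⁺ x∈)
  ∈-catMaybes⁺ {xs = nothing ∷ _} (there x∈)  = ∈-catMaybes⁺ x∈

  ∈-catMaybes⁻ : ∀ {x : A} xs → x ∈ catMaybes xs → just x ∈ xs
  ∈-catMaybes⁻ (just _  ∷ _)  (here refl) = here refl
  ∈-catMaybes⁻ (just _  ∷ xs) (there x∈)  = there (∈-catMaybes⁻ xs x∈)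
  ∈-catMaybes⁻ (nothing ∷ xs) x∈          = there (∈-catMaybes⁻ xs x∈)

  -- Finite sums and sequences of draws

  ∑ : List A → (A → ℕ) → ℕ
  ∑ xs f = sumℕ (map f xs)

  ∑-mono : ∀ (xs : List A) {f g : A → ℕ} → (∀ x → f x ≤ g x) → ∑ xs f ≤ ∑ xs g
  ∑-mono []       f≤g = z≤n
  ∑-mono (x ∷ xs) f≤g = ℕₚ.+-mono-≤ (f≤g x) (∑-mono xs f≤g)

  ∑-+ : ∀ (xs : List A) (f g : A → ℕ) → ∑ xs (λ x → f x + g x) ≡ ∑ xs f + ∑ xs g
  ∑-+ []       f g = refl
  ∑-+ (x ∷ xs) f g = trans (cong (f x + g x +_) (∑-+ xs f g))
    (+-*-Solver.solve 4 (λ a b c d → (a :+ b) :+ (c :+ d) := (a :+ c) :+ (b :+ d)) refl (f x) (g x) _ _)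
    where open +-*-Solver

  ∑-*ˡ : ∀ (xs : List A) c (f : A → ℕ) → ∑ xs (λ x → c * f x) ≡ c * ∑ xs f
  ∑-*ˡ []       c f = sym (ℕₚ.*-zeroʳ c)
  ∑-*ˡ (x ∷ xs) c f = trans (cong (c * f x +_) (∑-*ˡ xs c f)) (sym (ℕₚ.*-distribˡ-+ c (f x) _))

  ∑-const : ∀ (xs : List A) c → ∑ xs (λ _ → c) ≡ length xs * c
  ∑-const []       c = refl
  ∑-const (x ∷ xs) c = cong (c +_) (∑-const xs c)

  ∑-concatMap : ∀ (h : A → List B) xs f → ∑ (concatMap h xs) f ≡ ∑ xs (λ x → ∑ (h x) f)
  ∑-concatMap h []       f = refl
  ∑-concatMap h (x ∷ xs) f = trans (cong sumℕ (map-++ f (h x) (concatMap h xs)))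
    (trans (sum-++ (map f (h x)) _) (cong (∑ (h x) f +_) (∑-concatMap h xs f)))

  ∑-map : ∀ (h : A → B) xs f → ∑ (map h xs) f ≡ ∑ xs (f ∘ h)
  ∑-map h []       f = refl
  ∑-map h (x ∷ xs) f = cong (f (h x) +_) (∑-map h xs f)

  ∑-indicator : ∀ {P : A → Set} (P? : Decidable P) xs → ∑ xs (λ x → length (filter P? (x ∷ []))) ≡ length (filter P? xs)
  ∑-indicator P? []       = refl
  ∑-indicator P? (x ∷ xs) with P? x
  ... | yes _ = cong suc (∑-indicator P? xs)
  ... | no  _ = ∑-indicator P? xs

  -- The outer loop runs over the tail and the inner one over the head, so that a sum over all
  -- sequences first fixes the earlier draws and then varies a single new one.
  sequences : List A → ∀ m → List (Vec A m)
  sequences is zero    = [] ∷ []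
  sequences is (suc m) = concatMap (λ v → map (_∷ v) is) (sequences is m)

  ∑-sequences : ∀ (is : List A) m (g : Vec A (suc m) → ℕ) →
    ∑ (sequences is (suc m)) g ≡ ∑ (sequences is m) (λ v → ∑ is (λ i → g (i ∷ v)))
  ∑-sequences is m g = trans (∑-concatMap _ (sequences is m) g)
    (cong sumℕ (map-cong (λ v → ∑-map (_∷ v) is g) (sequences is m)))

  length-sequences : ∀ (is : List A) m → length (sequences is (suc m)) ≡ length (sequences is m) * length is
  length-sequences is m = begin
    length (sequences is (suc m))                           ≡⟨ ℕₚ.*-identityʳ _ ⟨
    length (sequences is (suc m)) * 1                       ≡⟨ ∑-const (sequences is (suc m)) 1 ⟨
    ∑ (sequences is (suc m)) (λ _ → 1)                      ≡⟨ ∑-sequences is m (λ _ → 1) ⟩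
    ∑ (sequences is m) (λ v → ∑ is (λ _ → 1))               ≡⟨ ∑-const (sequences is m) _ ⟩
    length (sequences is m) * ∑ is (λ _ → 1)                ≡⟨ cong (length (sequences is m) *_) (trans (∑-const is 1) (ℕₚ.*-identityʳ _)) ⟩
    length (sequences is m) * length is                     ∎
    where open ≡-Reasoning

  1≤length-sequences : ∀ (is : List A) → 1 ≤ length is → ∀ m → 1 ≤ length (sequences is m)
  1≤length-sequences is 1≤is zero    = ℕₚ.≤-refl
  1≤length-sequences is 1≤is (suc m) = subst (1 ≤_) (sym (length-sequences is m)) (ℕₚ.*-mono-≤ (1≤length-sequences is 1≤is m) 1≤is)

  -- Collisions when no bin holds more than `K` items

  module Fibres (is : List A) (f : A → ℕ) (K : ℕ)
    (fibre≤ : ∀ b → length (filter (λ i → f i ℕₚ.≟ b) is) ≤ K) where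

    -- Double counting: an entry `y` of `bs` is met exactly by the indices in the fibre of `y`, of
    -- which there are at most `K`.
    ∑-occurrences : ∀ bs → ∑ is (λ i → occurrences (f i) bs) ≤ length bs * K
    ∑-occurrences []       = ℕₚ.≤-reflexive (trans (∑-const is 0) (ℕₚ.*-zeroʳ (length is)))
    ∑-occurrences (y ∷ ys) = begin
      ∑ is (λ i → occurrences (f i) (y ∷ ys))
        ≤⟨ ∑-mono is (λ i → ℕₚ.≤-reflexive (split i)) ⟩
      ∑ is (λ i → length (filter (λ j → f j ℕₚ.≟ y) (i ∷ [])) + occurrences (f i) ys)
        ≡⟨ ∑-+ is _ _ ⟩
      ∑ is (λ i → length (filter (λ j → f j ℕₚ.≟ y) (i ∷ []))) + ∑ is (λ i → occurrences (f i) ys)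
        ≡⟨ cong (_+ _) (∑-indicator (λ j → f j ℕₚ.≟ y) is) ⟩
      length (filter (λ j → f j ℕₚ.≟ y) is) + ∑ is (λ i → occurrences (f i) ys)
        ≤⟨ ℕₚ.+-mono-≤ (fibre≤ y) (∑-occurrences ys) ⟩
      K + length ys * K ∎
      where
      open ℕₚ.≤-Reasoning
      split : ∀ i → occurrences (f i) (y ∷ ys) ≡ length (filter (λ j → f j ℕₚ.≟ y) (i ∷ [])) + occurrences (f i) ys
      -- Both filters decide `f i ≡ y`, and this decision computes to the Boolean `f i ≡ᵇ y`.
      split i with f i ≡ᵇ y
      ... | true  = refl
      ... | false = refl

    -- The same double counting read as a pigeonhole principle; it bounds the optimum from below
    -- while all items are present.
    length≤*bins : ∀ bs → (∀ i → f i ∈ bs) → length is ≤ length bs * K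
    length≤*bins bs f∈ = begin
      length is                          ≡⟨ ℕₚ.*-identityʳ _ ⟨
      length is * 1                      ≡⟨ ∑-const is 1 ⟨
      ∑ is (λ _ → 1)                     ≤⟨ ∑-mono is (λ i → ∈⇒1≤occurrences (f∈ i)) ⟩
      ∑ is (λ i → occurrences (f i) bs)  ≤⟨ ∑-occurrences bs ⟩
      length bs * K                      ∎
      where open ℕₚ.≤-Reasoning

    bins : ∀ {m} → Vec A m → List ℕ
    bins v = map f (toList v)

    length-bins : ∀ {m} (v : Vec A m) → length (bins v) ≡ m
    length-bins v = trans (length-map f (toList v)) (Vecₚ.length-toList v)

    totalDistinct : ℕ → ℕ
    totalDistinct m = ∑ (sequences is m) (λ v → #distinct (bins v))

    -- A new draw adds a bin unless it falls into one of the `m` bins already listed, and these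
    -- contain at most `m * K` of the possible draws.
    extend : ∀ {m} (v : Vec A m) → length is + length is * #distinct (bins v) ≤ ∑ is (λ i → #distinct (bins (i ∷ v))) + m * K
    extend {m} v = begin
      length is + length is * #distinct (bins v)                ≡⟨ ℕₚ.*-suc (length is) _ ⟨
      length is * (1 + #distinct (bins v))                      ≡⟨ ∑-const is _ ⟨
      ∑ is (λ _ → 1 + #distinct (bins v))                       ≤⟨ ∑-mono is (λ i → #distinct-∷ (f i) (bins v)) ⟩
      ∑ is (λ i → #distinct (bins (i ∷ v)) + occurrences (f i) (bins v))
                                                                ≡⟨ ∑-+ is _ _ ⟩
      ∑ is (λ i → #distinct (bins (i ∷ v))) + ∑ is (λ i → occurrences (f i) (bins v))
        ≤⟨ ℕₚ.+-monoʳ-≤ _ (∑-occurrences (bins v)) ⟩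
      ∑ is (λ i → #distinct (bins (i ∷ v))) + length (bins v) * K
        ≡⟨ cong (λ l → ∑ is (λ i → #distinct (bins (i ∷ v))) + l * K) (length-bins v) ⟩
      ∑ is (λ i → #distinct (bins (i ∷ v))) + m * K             ∎
      where open ℕₚ.≤-Reasoning

    totalDistinct-step : ∀ m → let N = length (sequences is m) in
      N * length is + length is * totalDistinct m ≤ totalDistinct (suc m) + N * (m * K)
    totalDistinct-step m = begin
      N * n + n * totalDistinct m
        ≡⟨ cong₂ _+_ (∑-const (sequences is m) n) (∑-*ˡ (sequences is m) n _) ⟨
      ∑ (sequences is m) (λ _ → n) + ∑ (sequences is m) (λ v → n * #distinct (bins v))
        ≡⟨ ∑-+ (sequences is m) _ _ ⟨
      ∑ (sequences is m) (λ v → n + n * #distinct (bins v))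
        ≤⟨ ∑-mono (sequences is m) extend ⟩
      ∑ (sequences is m) (λ v → ∑ is (λ i → #distinct (bins (i ∷ v))) + m * K)
        ≡⟨ ∑-+ (sequences is m) _ _ ⟩
      ∑ (sequences is m) (λ v → ∑ is (λ i → #distinct (bins (i ∷ v)))) + ∑ (sequences is m) (λ _ → m * K)
        ≡⟨ cong₂ _+_ (sym (∑-sequences is m _)) (∑-const (sequences is m) _) ⟩
      totalDistinct (suc m) + N * (m * K) ∎
      where
      open ℕₚ.≤-Reasoning
      N = length (sequences is m)
      n = length is

    module _ (size : length is ≡ K * K) where

      -- On average a sequence of length m has at least m - m (m - 1) / 2K
      -- distinct bins, because each pair of its entries collides with
      -- probability at most K / K².
      totalDistinct-lower : ∀ m → let N = length (sequences is m) in
        (2 * K + 1) * m * N ≤ 2 * K * totalDistinct m + m * m * N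
      totalDistinct-lower zero    = ℕₚ.≤-trans (ℕₚ.≤-reflexive (cong (_* 1) (ℕₚ.*-zeroʳ (2 * K + 1)))) z≤n
      totalDistinct-lower (suc m) = begin
        (2 * K + 1) * suc m * N′
          ≡⟨ cong ((2 * K + 1) * suc m *_) N′≡ ⟩
        (2 * K + 1) * suc m * (N * (K * K))
          ≡⟨ solve 3 (λ k m n → (con 2 :* k :+ con 1) :* (con 1 :+ m) :* (n :* (k :* k))
               := con 2 :* k :* (n :* (k :* k)) :+ n :* (k :* k) :+ (k :* k) :* ((con 2 :* k :+ con 1) :* m :* n)) refl K m N ⟩
        2 * K * (N * (K * K)) + N * (K * K) + (K * K) * ((2 * K + 1) * m * N)
          -- The induction hypothesis is scaled by `K * K`, the factor by which one more draw
          -- multiplies the number of sequences.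
          ≤⟨ ℕₚ.+-monoʳ-≤ (2 * K * (N * (K * K)) + N * (K * K)) (ℕₚ.*-monoʳ-≤ (K * K) (totalDistinct-lower m)) ⟩
        2 * K * (N * (K * K)) + N * (K * K) + (K * K) * (2 * K * T + m * m * N)
          ≡⟨ solve 4 (λ k m n t → con 2 :* k :* (n :* (k :* k)) :+ n :* (k :* k) :+ (k :* k) :* (con 2 :* k :* t :+ m :* m :* n)
               := con 2 :* k :* (n :* (k :* k) :+ k :* k :* t) :+ (n :* (k :* k) :+ m :* m :* (n :* (k :* k)))) refl K m N T ⟩
        2 * K * (N * (K * K) + K * K * T) + (N * (K * K) + m * m * (N * (K * K)))
          ≤⟨ ℕₚ.+-monoˡ-≤ (N * (K * K) + m * m * (N * (K * K))) (ℕₚ.*-monoʳ-≤ (2 * K) step) ⟩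
        2 * K * (T′ + N * (m * K)) + (N * (K * K) + m * m * (N * (K * K)))
          ≡⟨ solve 4 (λ k m n t → con 2 :* k :* (t :+ n :* (m :* k)) :+ (n :* (k :* k) :+ m :* m :* (n :* (k :* k)))
               := con 2 :* k :* t :+ (con 1 :+ m) :* (con 1 :+ m) :* (n :* (k :* k))) refl K m N T′ ⟩
        2 * K * T′ + suc m * suc m * (N * (K * K))
          ≡⟨ cong (λ x → 2 * K * T′ + suc m * suc m * x) N′≡ ⟨
        2 * K * T′ + suc m * suc m * N′ ∎
        where
        open ℕₚ.≤-Reasoning
        open +-*-Solver
        N = length (sequences is m)
        N′ = length (sequences is (suc m))
        T = totalDistinct m
        T′ = totalDistinct (suc m)
        N′≡ : N′ ≡ N * (K * K)
        N′≡ = trans (length-sequences is m) (cong (N *_) size)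
        step : N * (K * K) + K * K * T ≤ T′ + N * (m * K)
        step = subst (λ n → N * n + n * T ≤ T′ + N * (m * K)) size (totalDistinct-step m)

      -- At `m = K` the average `m - m (m - 1) / 2K` equals `(K + 1) / 2`, and a common factor `K`
      -- cancels.
      totalDistinct-half : .{{_ : NonZero K}} → (K + 1) * length (sequences is K) ≤ 2 * totalDistinct K
      totalDistinct-half = ℕₚ.+-cancelʳ-≤ (K * N) ((K + 1) * N) (2 * T) (ℕₚ.*-cancelˡ-≤ K (begin
        K * ((K + 1) * N + K * N)    ≡⟨ solve 2 (λ k n → k :* ((k :+ con 1) :* n :+ k :* n) := (con 2 :* k :+ con 1) :* k :* n) refl K N ⟩
        (2 * K + 1) * K * N          ≤⟨ totalDistinct-lower K ⟩
        2 * K * T + K * K * N        ≡⟨ solve 3 (λ k n t → con 2 :* k :* t :+ k :* k :* n := k :* (con 2 :* t :+ k :* n)) refl K N T ⟩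
        K * (2 * T + K * N)          ∎))
        where
        open ℕₚ.≤-Reasoning
        open +-*-Solver
        N = length (sequences is K)
        T = totalDistinct K

  -- An index with quotient `b` is `r + b * k` for some remainder `r < k`. Hence putting item `i`
  -- into bin `i / k` overfills no bin.
  quotient-fibre : ∀ k n .{{_ : NonZero k}} b → length (filter (λ (i : Fin n) → toℕ i / k ℕₚ.≟ b) (allFin n)) ≤ k
  quotient-fibre k n b = subst₂ _≤_ (length-map toℕ fibre) (trans (length-map _ (upTo k)) (length-upTo k))
    (unique-⊆⇒length≤ (Uniqueₚ.map⁺ Finₚ.toℕ-injective (Uniqueₚ.filter⁺ _ (Uniqueₚ.allFin⁺ n))) ⊆block)
    where
    fibre = filter (λ (i : Fin n) → toℕ i / k ℕₚ.≟ b) (allFin n)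
    ⊆block : map toℕ fibre ⊆ map (λ r → r + b * k) (upTo k)
    ⊆block z∈ with ∈-map⁻ toℕ z∈
    ... | i , i∈ , refl with ∈-filter⁻ (λ (i : Fin n) → toℕ i / k ℕₚ.≟ b) {xs = allFin n} i∈
    ... | _ , refl = subst (_∈ map (λ r → r + b * k) (upTo k)) (sym (m≡m%n+[m/n]*n (toℕ i) k))
      (∈-map⁺ (λ r → r + b * k) (∈-upTo⁺ (m%n<n (toℕ i) k)))

  -- On the right is four times the guaranteed survivor bins integrated up to `1 + k * k`; on the
  -- left `k` times the optimum plus the allowance for migration, all summed over `N` draws. The gap
  -- is `N * (2 + (k + k * k))`.
  survivor-phase-dominates : ∀ {N} → 1 ≤ N → ∀ k →
    N * (k * (k + k * k)) + N * (k * suc (k * k)) < 2 * (k + 1) * N * suc (k * k)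
  survivor-phase-dominates {N} 1≤N k = subst (X <_) (sym eq) (ℕₚ.m<m+n X (ℕₚ.*-mono-≤ 1≤N (s≤s z≤n)))
    where
    open +-*-Solver
    X = N * (k * (k + k * k)) + N * (k * suc (k * k))
    eq : 2 * (k + 1) * N * suc (k * k) ≡ X + N * (2 + (k + k * k))
    eq = solve 2 (λ N k → con 2 :* (k :+ con 1) :* N :* (con 1 :+ k :* k)
      := N :* (k :* (k :+ k :* k)) :+ N :* (k :* (con 1 :+ k :* k)) :+ N :* (con 2 :+ (k :+ k :* k))) refl N k

open Counting

-- Arithmetic of ordered fields

module OrderedField (R : RealNumbers) where
  open RealNumbers R
  open CommutativeRing commutativeRing public using
    ( +-comm; +-assoc; +-identityˡ; +-identityʳ; -‿inverseˡ; -‿inverseʳ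
    ; *-comm; *-assoc; *-identityˡ; *-identityʳ; zeroˡ; zeroʳ; distribˡ; distribʳ
    ; +-monoid; semiring; commutativeSemiring)
  open IsDecTotalOrder isDecTotalOrder public using () renaming
    (refl to ≤-refl; reflexive to ≤-reflexive; trans to ≤-trans; antisym to ≤-antisym; total to ≤-total)
  open RingProperties (CommutativeRing.ring commutativeRing) public using (-‿distribˡ-*)
  open SemiringSolver commutativeSemiring public using (solve; _:+_; _:*_; _:=_; con)

  ≤-poset : Poset _ _ _
  ≤-poset = record { isPartialOrder = IsDecTotalOrder.isPartialOrder isDecTotalOrder }

  module ≤-R = PartialOrderReasoning ≤-poset

  ≰⇒> : ∀ {x y} → ¬ x ≤ y → y < x
  ≰⇒> = Strict.≰⇒> _≡_ _≤_ sym ≤-reflexive ≤-total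

  ≮⇒≥ : ∀ {x y} → ¬ x < y → y ≤ x
  ≮⇒≥ = Strict.≮⇒≥ _≡_ _≤_ sym _≟_ ≤-reflexive ≤-total

  <⇒≱ : ∀ {x y} → x < y → ¬ y ≤ x
  <⇒≱ = Strict.<⇒≱ _≡_ _≤_ ≤-antisym

  ≤-<-trans : ∀ {x y z} → x ≤ y → y < z → x < z
  ≤-<-trans x≤y (y≤z , y≢z) = ≤-trans x≤y y≤z , λ { refl → y≢z (≤-antisym y≤z x≤y) }

  <-≤-trans : ∀ {x y z} → x < y → y ≤ z → x < z
  <-≤-trans (x≤y , x≢y) y≤z = ≤-trans x≤y y≤z , λ { refl → x≢y (≤-antisym x≤y y≤z) }

  +-monoʳ-≤ : ∀ z {x y} → x ≤ y → z + x ≤ z + y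
  +-monoʳ-≤ z {x} {y} x≤y = subst₂ _≤_ (+-comm x z) (+-comm y z) (+-monoˡ-≤ z x≤y)

  +-mono-≤ : ∀ {x y u v} → x ≤ y → u ≤ v → x + u ≤ y + v
  +-mono-≤ {y = y} {u} x≤y u≤v = ≤-trans (+-monoˡ-≤ u x≤y) (+-monoʳ-≤ y u≤v)

  m+n-n≡m : ∀ x y → x + y - y ≡ x
  m+n-n≡m x y = trans (+-assoc x y (- y)) (trans (cong (x +_) (-‿inverseʳ y)) (+-identityʳ x))

  m-n+n≡m : ∀ x y → x - y + y ≡ x
  m-n+n≡m x y = trans (+-assoc x (- y) y) (trans (cong (x +_) (-‿inverseˡ y)) (+-identityʳ x))

  +-cancelʳ-≤ : ∀ z {x y} → x + z ≤ y + z → x ≤ y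
  +-cancelʳ-≤ z {x} {y} p = subst₂ _≤_ (m+n-n≡m x z) (m+n-n≡m y z) (+-monoˡ-≤ (- z) p)

  +-cancelʳ-≡ : ∀ z {x y} → x + z ≡ y + z → x ≡ y
  +-cancelʳ-≡ z {x} {y} p = trans (sym (m+n-n≡m x z)) (trans (cong (_- z) p) (m+n-n≡m y z))

  +-monoˡ-< : ∀ z {x y} → x < y → x + z < y + z
  +-monoˡ-< z (x≤y , x≢y) = +-monoˡ-≤ z x≤y , λ e → x≢y (+-cancelʳ-≡ z e)

  +-cancelʳ-< : ∀ z {x y} → x + z < y + z → x < y
  +-cancelʳ-< z (p , q) = +-cancelʳ-≤ z p , λ e → q (cong (_+ z) e)

  -- Replaces the subtraction y - x by a nonnegative variable d, so that the
  -- semiring solver applies.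
  ≤⇒∃+ : ∀ {x y} → x ≤ y → ∃[ d ] 0# ≤ d × y ≡ x + d
  ≤⇒∃+ {x} {y} x≤y = y - x
    , +-cancelʳ-≤ x (subst₂ _≤_ (sym (+-identityˡ x)) (sym (m-n+n≡m y x)) x≤y)
    , sym (trans (+-comm x _) (m-n+n≡m y x))

  [m+n]-m≡n : ∀ x y → x + y - x ≡ y
  [m+n]-m≡n x y = trans (cong (_- x) (+-comm x y)) (m+n-n≡m y x)

  x≤x+y : ∀ x {y} → 0# ≤ y → x ≤ x + y
  x≤x+y x {y} 0≤y = subst (_≤ x + y) (+-identityʳ x) (+-monoʳ-≤ x 0≤y)

  x≤y+x : ∀ {x} y → 0# ≤ y → x ≤ y + x
  x≤y+x {x} y 0≤y = subst (x ≤_) (+-comm x y) (x≤x+y x 0≤y)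

  0≤+ : ∀ {x y} → 0# ≤ x → 0# ≤ y → 0# ≤ x + y
  0≤+ {x} 0≤x 0≤y = ≤-trans 0≤x (x≤x+y x 0≤y)

  x≤y⇒0≤y-x : ∀ {x y} → x ≤ y → 0# ≤ y - x
  x≤y⇒0≤y-x {x} {y} x≤y = subst (_≤ y - x) (-‿inverseʳ x) (+-monoˡ-≤ (- x) x≤y)

  *-monoʳ-≤ : ∀ {z x y} → 0# ≤ z → x ≤ y → z * x ≤ z * y
  *-monoʳ-≤ {z} {x} 0≤z x≤y with ≤⇒∃+ x≤y
  ... | d , 0≤d , refl = subst (z * x ≤_) (sym (distribˡ z x d)) (x≤x+y _ (*-nonneg 0≤z 0≤d))

  *-monoˡ-≤ : ∀ {z x y} → 0# ≤ z → x ≤ y → x * z ≤ y * z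
  *-monoˡ-≤ {z} {x} {y} 0≤z x≤y = subst₂ _≤_ (*-comm z x) (*-comm z y) (*-monoʳ-≤ 0≤z x≤y)

  neg-≤ : ∀ {x y} → x ≤ y → - y ≤ - x
  neg-≤ {x} {y} x≤y = +-cancelʳ-≤ y (subst₂ _≤_ (sym (-‿inverseˡ y)) (+-comm y (- x)) (x≤y⇒0≤y-x x≤y))

  neg-involutive : ∀ x → - (- x) ≡ x
  neg-involutive = RingProperties.-‿involutive (CommutativeRing.ring commutativeRing)

  0≤1 : 0# ≤ 1#
  0≤1 with ≤-total 0# 1#
  ... | inj₁ 0≤1 = 0≤1
  ... | inj₂ 1≤0 = subst (0# ≤_) eq (*-nonneg 0≤-1 0≤-1)
    where
    0≤-1 : 0# ≤ - 1#
    0≤-1 = subst (0# ≤_) (+-identityˡ _) (x≤y⇒0≤y-x 1≤0)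
    eq : - 1# * - 1# ≡ 1#
    eq = trans (sym (-‿distribˡ-* 1# (- 1#))) (trans (cong -_ (*-identityˡ _)) (neg-involutive 1#))

  0<1 : 0# < 1#
  0<1 = 0≤1 , 0≢1

  *-inverseˡ : ∀ {x} → 0# < x → x ⁻¹ * x ≡ 1#
  *-inverseˡ {x} (_ , 0≢x) = trans (*-comm _ x) (*-inverseʳ x (λ e → 0≢x (sym e)))

  x⁻¹*[x*y]≡y : ∀ {x} y → 0# < x → x ⁻¹ * (x * y) ≡ y
  x⁻¹*[x*y]≡y {x} y 0<x = trans (sym (*-assoc _ x y)) (trans (cong (_* y) (*-inverseˡ 0<x)) (*-identityˡ y))

  x*[x⁻¹*y]≡y : ∀ {x} y → 0# < x → x * (x ⁻¹ * y) ≡ y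
  x*[x⁻¹*y]≡y {x} y 0<x = trans (sym (*-assoc x _ y))
    (trans (cong (_* y) (trans (*-comm x _) (*-inverseˡ 0<x))) (*-identityˡ y))

  *-pos : ∀ {x y} → 0# < x → 0# < y → 0# < x * y
  *-pos {x} {y} 0<x (0≤y , 0≢y) = *-nonneg (proj₁ 0<x) 0≤y , λ e →
    0≢y (trans (sym (zeroʳ (x ⁻¹))) (trans (cong (x ⁻¹ *_) e) (x⁻¹*[x*y]≡y y 0<x)))

  *-monoʳ-< : ∀ {z x y} → 0# < z → x < y → z * x < z * y
  *-monoʳ-< {z} {x} {y} 0<z (x≤y , x≢y) = *-monoʳ-≤ (proj₁ 0<z) x≤y , λ e →
    x≢y (trans (sym (x⁻¹*[x*y]≡y x 0<z)) (trans (cong (z ⁻¹ *_) e) (x⁻¹*[x*y]≡y y 0<z)))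

  *-cancelˡ-≤ : ∀ {z x y} → 0# < z → z * x ≤ z * y → x ≤ y
  *-cancelˡ-≤ {z} {x} {y} 0<z p with x ≤? y
  ... | yes x≤y = x≤y
  ... | no  x≰y = contradiction p (<⇒≱ (*-monoʳ-< 0<z (≰⇒> x≰y)))

  *-cancelˡ-< : ∀ {z x y} → 0# < z → z * x < z * y → x < y
  *-cancelˡ-< {z} 0<z (p , q) = *-cancelˡ-≤ 0<z p , λ e → q (cong (z *_) e)

  0<⁻¹ : ∀ {x} → 0# < x → 0# < x ⁻¹
  0<⁻¹ {x} 0<x = *-cancelˡ-< 0<x
    (subst₂ _<_ (sym (zeroʳ x)) (sym (trans (*-comm x _) (*-inverseˡ 0<x))) 0<1)

  fromℕ-+ : ∀ m n → fromℕ (m ℕ.+ n) ≡ fromℕ m + fromℕ n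
  fromℕ-+ = MonoidMult.×-homo-+ +-monoid 1#

  fromℕ-* : ∀ m n → fromℕ (m ℕ.* n) ≡ fromℕ m * fromℕ n
  fromℕ-* = SemiringMult.×1-homo-* semiring

  fromℕ-1 : fromℕ 1 ≡ 1#
  fromℕ-1 = +-identityʳ 1#

  ·≡fromℕ* : ∀ n x → n · x ≡ fromℕ n * x
  ·≡fromℕ* n x = trans (cong (n ·_) (sym (*-identityˡ x))) (sym (SemiringMult.×-assoc-* semiring n 1# x))

  0≤fromℕ : ∀ n → 0# ≤ fromℕ n
  0≤fromℕ zero    = ≤-refl
  0≤fromℕ (suc n) = 0≤+ 0≤1 (0≤fromℕ n)

  fromℕ-mono-≤ : ∀ {m n} → m ℕ.≤ n → fromℕ m ≤ fromℕ n
  fromℕ-mono-≤ {n = n} ℕ.z≤n = 0≤fromℕ n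
  fromℕ-mono-≤ (ℕ.s≤s p) = +-monoʳ-≤ 1# (fromℕ-mono-≤ p)

  fromℕ-mono-< : ∀ {m n} → m ℕ.< n → fromℕ m < fromℕ n
  fromℕ-mono-< {m} p = <-≤-trans
    (subst (_< fromℕ (suc m)) (+-identityˡ _) (+-monoˡ-< (fromℕ m) 0<1)) (fromℕ-mono-≤ p)

  fromℕ-cancel-≤ : ∀ {m n} → fromℕ m ≤ fromℕ n → m ℕ.≤ n
  fromℕ-cancel-≤ {m} {n} p with m ℕₚ.≤? n
  ... | yes m≤n = m≤n
  ... | no  m≰n = contradiction p (<⇒≱ (fromℕ-mono-< (ℕₚ.≰⇒> m≰n)))

module LowerBounds (R : RealNumbers) where
  open OrderedField R
  open RealNumbers R
  open BinPacking R

  -- Events and integrals of simple functions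

  module Probability (S : ProbabilitySpace) where
    open ProbabilitySpace S
    open SimpleFunction

    -- Decidability makes events stable under double negation, hence closed
    -- under intersection.
    record Event : Set₁ where
      field
        pred       : Pred Ω 0ℓ
        measurable : Measurable pred
        dec        : ∀ ω → Dec (pred ω)

    open Event

    pr : Event → ℝ
    pr A = P (measurable A)

    Uᵉ ∅ᵉ : Event
    Uᵉ = record { pred = U ; measurable = measurable-U ; dec = λ _ → yes tt }
    ∅ᵉ = record { pred = ∁ U ; measurable = measurable-∁ measurable-U ; dec = λ _ → no (λ ¬tt → ¬tt tt) }

    ∁ᵉ : Event → Event
    ∁ᵉ A = record { pred = ∁ (pred A) ; measurable = measurable-∁ (measurable A) ; dec = λ ω → ¬? (dec A ω) }

    -- The countable union of `A, B, B, ...`; measurability is unaffected by the repetition.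
    _∪ᵉ_ : Event → Event → Event
    A ∪ᵉ B = record
      { pred       = pred A ∪ pred B
      ; measurable = measurable-resp
          ( (λ { (zero , a) → inj₁ a ; (suc _ , b) → inj₂ b })
          , (λ { (inj₁ a) → zero , a ; (inj₂ b) → 1 , b }))
          (measurable-⋃ {A = family} λ { zero → measurable A ; (suc _) → measurable B })
      ; dec        = λ ω → dec A ω ⊎-dec dec B ω
      }
      where
      family : ℕ → Pred Ω 0ℓ
      family zero    = pred A
      family (suc _) = pred B

    _∩ᵉ_ : Event → Event → Event
    A ∩ᵉ B = record
      { pred       = pred A ∩ pred B
      ; measurable = measurable-resp
          ( (λ {ω} n → decidable-stable (dec A ω) (n ∘ inj₁) , decidable-stable (dec B ω) (n ∘ inj₂))
          , (λ { (a , b) (inj₁ ¬a) → ¬a a ; (a , b) (inj₂ ¬b) → ¬b b }))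
          (measurable (∁ᵉ (∁ᵉ A ∪ᵉ ∁ᵉ B)))
      ; dec        = λ ω → dec A ω ×-dec dec B ω
      }

    constᵉ : {Q : Set} → Dec Q → Event
    constᵉ {Q} Q? = record { pred = λ _ → Q ; measurable = meas Q? ; dec = λ _ → Q? }
      where
      meas : Dec Q → Measurable (λ _ → Q)
      meas (yes q) = measurable-resp ((λ _ → q) , (λ _ → tt)) measurable-U
      meas (no ¬q) = measurable-resp ((λ ¬tt → contradiction tt ¬tt) , (λ q → contradiction q ¬q)) (measurable ∅ᵉ)

    -- For a sequence of empty events the partial sum of length two is at most the probability of
    -- the union, so `p + p ≤ p` for `p = pr ∅ᵉ`.
    pr-∅ : pr ∅ᵉ ≡ 0#
    pr-∅ = ≤-antisym (+-cancelʳ-≤ (pr ∅ᵉ) (begin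
      pr ∅ᵉ + pr ∅ᵉ                              ≡⟨ cong (pr ∅ᵉ +_) (+-identityʳ (pr ∅ᵉ)) ⟨
      pr ∅ᵉ + (pr ∅ᵉ + 0#)                       ≤⟨ proj₁ (P-σ-additive empty (λ ¬tt _ → contradiction tt ¬tt)) _ (2 , refl) ⟩
      P (measurable-⋃ empty)                     ≡⟨ P-cong (proj₂ , (0 ,_)) _ _ ⟩
      pr ∅ᵉ                                      ≡⟨ +-identityˡ _ ⟨
      0# + pr ∅ᵉ                                 ∎)) (P-nonneg _)
      where
      open ≤-R
      empty : (n : ℕ) → Measurable (∁ U)
      empty _ = measurable ∅ᵉ

    sum-pr-∅ : ∀ n → sum {n} (λ _ → pr ∅ᵉ) ≡ 0#
    sum-pr-∅ zero    = refl
    sum-pr-∅ (suc n) = trans (cong₂ _+_ pr-∅ (sum-pr-∅ n)) (+-identityʳ 0#)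

    -- Finite additivity from the countable one: the family `B ∩ᵉ A, B ∩ᵉ ∁ᵉ A, ∅ᵉ, ∅ᵉ, ...` has
    -- partial sums that are constant from length two on.
    pr-split : ∀ B A → pr B ≡ pr (B ∩ᵉ A) + pr (B ∩ᵉ ∁ᵉ A)
    pr-split B A = trans (P-cong B≐⋃ _ _) (≤-antisym
      (proj₂ sup _ (λ { x (n , refl) → partial n }))
      (subst (_≤ P (measurable-⋃ (measurable ∘ family))) (cong (pr (B ∩ᵉ A) +_) (+-identityʳ _)) (proj₁ sup _ (2 , refl))))
      where
      family : ℕ → Event
      family 0             = B ∩ᵉ A
      family 1             = B ∩ᵉ ∁ᵉ A
      family (suc (suc _)) = ∅ᵉ
      disjoint : ∀ {m n ω} → pred (family m) ω → pred (family n) ω → m ≡ n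
      disjoint {0} {0} _ _ = refl
      disjoint {1} {1} _ _ = refl
      disjoint {0} {1} (_ , a) (_ , ¬a) = contradiction a ¬a
      disjoint {1} {0} (_ , ¬a) (_ , a) = contradiction a ¬a
      disjoint {suc (suc _)} ¬tt _ = contradiction tt ¬tt
      disjoint {0} {suc (suc _)} _ ¬tt = contradiction tt ¬tt
      disjoint {1} {suc (suc _)} _ ¬tt = contradiction tt ¬tt
      sup = P-σ-additive (measurable ∘ family) (λ {m} {n} → disjoint {m} {n})
      B≐⋃ : pred B ≐ ⋃ ℕ (pred ∘ family)
      B≐⋃ = to , λ { (0 , b , _) → b ; (1 , b , _) → b ; (suc (suc _) , ¬tt) → contradiction tt ¬tt }
        where
        to : ∀ {ω} → pred B ω → ⋃ ℕ (pred ∘ family) ω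
        to {ω} b with dec A ω
        ... | yes a = 0 , b , a
        ... | no ¬a = 1 , b , ¬a
      partial : ∀ n → sum {n} (λ i → pr (family (toℕ i))) ≤ pr (B ∩ᵉ A) + pr (B ∩ᵉ ∁ᵉ A)
      partial 0             = 0≤+ (P-nonneg _) (P-nonneg _)
      partial 1             = +-monoʳ-≤ _ (P-nonneg _)
      partial (suc (suc n)) = ≤-reflexive (cong (pr (B ∩ᵉ A) +_)
        (trans (cong (pr (B ∩ᵉ ∁ᵉ A) +_) (sum-pr-∅ n)) (+-identityʳ _)))

    -- A list stands for the sum of `w` times the indicator of `A` over its pairs. Events may
    -- overlap and weights may be negative, so adding simple functions is concatenation and no
    -- common refinement is formed.
    WeightedEvents : Set₁
    WeightedEvents = List (ℝ × Event)

    value : WeightedEvents → Ω → ℝ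
    value es ω = foldr (λ (w , A) acc → (if does (dec A ω) then w else 0#) + acc) 0# es

    -- The integral of `value es` over `B`. The domain is a parameter because the induction in
    -- `mass-lower` restricts it.
    mass : WeightedEvents → Event → ℝ
    mass es B = foldr (λ (w , A) acc → w * pr (B ∩ᵉ A) + acc) 0# es

    mass-split : ∀ es B A → mass es B ≡ mass es (B ∩ᵉ A) + mass es (B ∩ᵉ ∁ᵉ A)
    mass-split []             B A = sym (+-identityʳ 0#)
    mass-split ((w , E) ∷ es) B A = trans
      (cong₂ _+_ (cong (w *_) (trans (pr-split (B ∩ᵉ E) A) (cong₂ _+_ (swap A) (swap (∁ᵉ A))))) (mass-split es B A))
      (solve 5 (λ w p q m n → w :* (p :+ q) :+ (m :+ n) := (w :* p :+ m) :+ (w :* q :+ n)) refl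
        w (pr ((B ∩ᵉ A) ∩ᵉ E)) (pr ((B ∩ᵉ ∁ᵉ A) ∩ᵉ E)) (mass es (B ∩ᵉ A)) (mass es (B ∩ᵉ ∁ᵉ A)))
      where
      swap : ∀ A → pr ((B ∩ᵉ E) ∩ᵉ A) ≡ pr ((B ∩ᵉ A) ∩ᵉ E)
      swap A = P-cong ((λ { ((b , e) , a) → (b , a) , e }) , (λ { ((b , a) , e) → (b , e) , a })) _ _

    -- The first event `A` splits `B`. Inside `A` the remaining list has to reach only `C - w`,
    -- outside it still has to reach `C`; both halves follow by induction.
    mass-lower : ∀ es B C → (∀ ω → pred B ω → C ≤ value es ω) → C * pr B ≤ mass es B
    mass-lower [] B C C≤ with C ≤? 0#
    ... | yes C≤0 = subst (C * pr B ≤_) (zeroˡ (pr B)) (*-monoˡ-≤ (P-nonneg _) C≤0)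
    -- A positive `C` below the empty sum leaves no outcome in `B`.
    ... | no  C≰0 = ≤-reflexive (trans (cong (C *_) prB≡0) (zeroʳ C))
      where
      prB≡0 : pr B ≡ 0#
      prB≡0 = trans (P-cong ((λ {ω} b → contradiction (C≤ ω b) C≰0) , (λ ¬tt → contradiction tt ¬tt)) _ _) pr-∅
    mass-lower ((w , A) ∷ es) B C C≤ = begin
      C * pr B                                 ≡⟨ cong (C *_) (pr-split B A) ⟩
      C * (p + q)                              ≡⟨ distribˡ C p q ⟩
      C * p + C * q                            ≡⟨ cong (λ c → c * p + C * q) (sym (m-n+n≡m C w)) ⟩
      (C - w + w) * p + C * q                  ≡⟨ solve 5 (λ d w p c q → (d :+ w) :* p :+ c :* q := w :* p :+ (d :* p :+ c :* q)) refl (C - w) w p C q ⟩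
      w * p + ((C - w) * p + C * q)            ≤⟨ +-monoʳ-≤ (w * p) (+-mono-≤ (mass-lower es (B ∩ᵉ A) (C - w) inside) (mass-lower es (B ∩ᵉ ∁ᵉ A) C outside)) ⟩
      w * p + (mass es (B ∩ᵉ A) + mass es (B ∩ᵉ ∁ᵉ A)) ≡⟨ cong (w * p +_) (mass-split es B A) ⟨
      w * p + mass es B                        ∎
      where
      open ≤-R
      p = pr (B ∩ᵉ A)
      q = pr (B ∩ᵉ ∁ᵉ A)
      inside : ∀ ω → pred (B ∩ᵉ A) ω → C - w ≤ value es ω
      inside ω (b , a) with dec A ω | C≤ ω b
      ... | yes _ | C≤w+v = subst (C - w ≤_) ([m+n]-m≡n w (value es ω)) (+-monoˡ-≤ (- w) C≤w+v)
      ... | no ¬a | _     = contradiction a ¬a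
      outside : ∀ ω → pred (B ∩ᵉ ∁ᵉ A) ω → C ≤ value es ω
      outside ω (b , ¬a) with dec A ω | C≤ ω b
      ... | yes a | _     = contradiction a ¬a
      ... | no  _ | C≤0+v = subst (C ≤_) (+-identityˡ _) C≤0+v

    levelEvent : SimpleFunction → ℝ → Event
    levelEvent φ v = record { pred = λ ω → fun φ ω ≡ v ; measurable = level φ v ; dec = λ ω → fun φ ω ≟ v }

    levels : ℝ → SimpleFunction → List ℝ → WeightedEvents
    levels w φ = map (λ v → w * v , levelEvent φ v)

    value-levels-∉ : ∀ w φ vs es ω → fun φ ω ∉ vs → value (levels w φ vs ++ es) ω ≡ value es ω
    value-levels-∉ w φ []       es ω _ = refl
    value-levels-∉ w φ (v ∷ vs) es ω x∉ with fun φ ω ≟ v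
    ... | yes x≡v = contradiction (here x≡v) x∉
    ... | no  _   = trans (+-identityˡ _) (value-levels-∉ w φ vs es ω (x∉ ∘ there))

    -- Since the values are distinct, exactly one level event contains `ω`.
    value-levels : ∀ w φ vs es ω → Unique vs → fun φ ω ∈ vs → value (levels w φ vs ++ es) ω ≡ w * fun φ ω + value es ω
    value-levels w φ (v ∷ vs) es ω u@(_ ∷ uvs) x∈ with fun φ ω ≟ v | x∈
    ... | yes refl | _        = cong (w * v +_) (value-levels-∉ w φ vs es ω (Uniqueₚ.Unique[x∷xs]⇒x∉xs u))
    ... | no  x≢v  | here x≡v = contradiction x≡v x≢v
    ... | no  _    | there x∈vs = trans (+-identityˡ _) (value-levels w φ vs es ω uvs x∈vs)

    mass-levels : ∀ w φ vs es →
      mass (levels w φ vs ++ es) Uᵉ ≡ w * foldr (λ v acc → v * P (level φ v) + acc) 0# vs + mass es Uᵉ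
    mass-levels w φ []       es = sym (trans (cong (_+ mass es Uᵉ) (zeroʳ w)) (+-identityˡ _))
    mass-levels w φ (v ∷ vs) es = trans
      (cong₂ _+_ (cong (w * v *_) (P-cong (proj₂ , (tt ,_)) _ (level φ v))) (mass-levels w φ vs es))
      (solve 5 (λ w v p a m → w :* v :* p :+ (w :* a :+ m) := w :* (v :* p :+ a) :+ m) refl
        w v (P (level φ v)) (foldr (λ v acc → v * P (level φ v) + acc) 0# vs) (mass es Uᵉ))

    allLevels : List (ℝ × SimpleFunction) → WeightedEvents
    allLevels = concatMap (λ (w , φ) → levels w φ (values φ))

    combination : List (ℝ × SimpleFunction) → Ω → ℝ
    combination φs ω = foldr (λ (w , φ) acc → w * fun φ ω + acc) 0# φs

    combinationIntegral : List (ℝ × SimpleFunction) → ℝ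
    combinationIntegral = foldr (λ (w , φ) acc → w * simpleIntegral φ + acc) 0#

    -- Linearity and monotonicity of the integral in a single statement, obtained by flattening all
    -- simple functions into their level events. Weights of either sign are allowed.
    combination-lower : ∀ φs C → (∀ ω → C ≤ combination φs ω) → C ≤ combinationIntegral φs
    combination-lower φs C C≤ = subst₂ _≤_ (trans (cong (C *_) P-U) (*-identityʳ C)) (mass≡ φs)
      (mass-lower (allLevels φs) Uᵉ C (λ ω _ → subst (C ≤_) (sym (value≡ φs ω)) (C≤ ω)))
      where
      value≡ : ∀ φs ω → value (allLevels φs) ω ≡ combination φs ω
      value≡ []             ω = refl
      value≡ ((w , φ) ∷ φs) ω = trans (value-levels w φ (values φ) (allLevels φs) ω (distinct φ) (range φ ω))
        (cong (w * fun φ ω +_) (value≡ φs ω))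
      mass≡ : ∀ φs → mass (allLevels φs) Uᵉ ≡ combinationIntegral φs
      mass≡ []             = refl
      mass≡ ((w , φ) ∷ φs) = trans (mass-levels w φ (values φ) (allLevels φs)) (cong (w * simpleIntegral φ +_) (mass≡ φs))

    -- The lower bound applied to `φ` with weight `- 1#`.
    simpleIntegral-upper : ∀ φ K → (∀ ω → fun φ ω ≤ K) → simpleIntegral φ ≤ K
    simpleIntegral-upper φ K φ≤K = subst₂ _≤_ (neg-involutive _) (neg-involutive K) (neg-≤
      (subst (- K ≤_) (-1* (simpleIntegral φ)) (combination-lower ((- 1# , φ) ∷ []) (- K)
        (λ ω → subst (- K ≤_) (sym (-1* (fun φ ω))) (neg-≤ (φ≤K ω))))))
      where
      -1* : ∀ x → - 1# * x + 0# ≡ - x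
      -1* x = trans (+-identityʳ _) (trans (sym (-‿distribˡ-* 1# x)) (cong -_ (*-identityˡ x)))

    zeroFunction : SimpleFunction
    zeroFunction = record
      { fun      = λ _ → 0#
      ; nonneg   = λ _ → ≤-refl
      ; values   = 0# ∷ []
      ; distinct = [] ∷ []
      ; range    = λ _ → here refl
      ; level    = λ v → measurable (constᵉ (0# ≟ v))
      }

    -- A competitive ratio has to exhibit the expected cost. Completeness supplies it: the zero
    -- function is admissible, and `K` bounds all integrals in question.
    expectation-exists : ∀ X K → (∀ ω → 0# ≤ X ω) → (∀ ω → X ω ≤ K) → ∃[ e ] HasExpectation X e
    expectation-exists X K 0≤X X≤K = complete _ (_ , zeroFunction , 0≤X , refl)
      (K , λ { _ (φ , φ≤X , refl) → simpleIntegral-upper φ K (λ ω → ≤-trans (φ≤X ω) (X≤K ω)) })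

    -- Approximating a random variable from below by simple functions

    module Staircase (X : Ω → ℝ) (rv : IsRandomVariable X) (0≤X : ∀ ω → 0# ≤ X ω) (δ : ℝ) (0<δ : 0# < δ) where

      step : ℕ → ℝ
      step m = fromℕ m * δ

      step-< : ∀ m → step m < step (suc m)
      step-< m = subst₂ _<_ (*-comm δ _) (*-comm δ _) (*-monoʳ-< 0<δ (fromℕ-mono-< (ℕₚ.n<1+n m)))

      0≤step : ∀ m → 0# ≤ step m
      0≤step m = *-nonneg (0≤fromℕ m) (proj₁ 0<δ)

      -- A staircase with `m` steps of height `δ`: it lags behind `X` by at most `δ` unless it has
      -- reached its cap `step m`. The field `bounded` makes the value added by the next step a
      -- fresh one.
      record Approximation (m : ℕ) : Set where
        field
          φ       : SimpleFunction
          below   : ∀ ω → fun φ ω ≤ X ω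
          close   : ∀ ω → X ω ≤ fun φ ω + δ ⊎ step m ≤ fun φ ω
          bounded : All (_≤ step m) (values φ)

      open Approximation

      staircase : ∀ m → Approximation m
      staircase zero = record
        { φ       = zeroFunction
        ; below   = 0≤X
        ; close   = λ _ → inj₂ (≤-reflexive (zeroˡ δ))
        ; bounded = 0≤step 0 ∷ []
        }
      staircase (suc m) = record
        { φ = record
          { fun      = next
          ; nonneg   = nonneg′
          ; values   = c ∷ values ψ
          ; distinct = All.map (λ { v≤ refl → <⇒≱ (step-< m) v≤ }) (bounded prev) ∷ distinct ψ
          ; range    = range′
          ; level    = level′
          }
        ; below   = below′
        ; close   = close′
        ; bounded = ≤-refl ∷ All.map (λ v≤ → ≤-trans v≤ (proj₁ (step-< m))) (bounded prev)
        }
        where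
        prev = staircase m
        ψ = φ prev
        c = step (suc m)
        next : Ω → ℝ
        next ω = if does (X ω ≤? c) then fun ψ ω else c
        nonneg′ : ∀ ω → 0# ≤ next ω
        nonneg′ ω with X ω ≤? c
        ... | yes _ = nonneg ψ ω
        ... | no  _ = 0≤step (suc m)
        range′ : ∀ ω → next ω ∈ c ∷ values ψ
        range′ ω with X ω ≤? c
        ... | yes _ = there (range ψ ω)
        ... | no  _ = here refl
        below′ : ∀ ω → next ω ≤ X ω
        below′ ω with X ω ≤? c
        ... | yes _   = below prev ω
        ... | no  X≰c = proj₁ (≰⇒> X≰c)
        close′ : ∀ ω → X ω ≤ next ω + δ ⊎ c ≤ next ω
        close′ ω with X ω ≤? c
        ... | no  _   = inj₂ ≤-refl
        ... | yes X≤c with close prev ω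
        ...   | inj₁ X≤φ+δ  = inj₁ X≤φ+δ
        -- Where the old staircase was capped, `X ω ≤ c` and `c` is `step m + δ`, so the old value
        -- is within `δ` after all.
        ...   | inj₂ step≤φ = inj₁ (≤-trans X≤c (≤-trans
          (≤-reflexive (trans (distribʳ δ 1# (fromℕ m)) (trans (cong (_+ step m) (*-identityˡ δ)) (+-comm δ _))))
          (+-monoˡ-≤ δ step≤φ)))
        X≤c : Event
        X≤c = record { pred = λ ω → X ω ≤ c ; measurable = rv c ; dec = λ ω → X ω ≤? c }
        level′ : ∀ v → Measurable (λ ω → next ω ≡ v)
        level′ v = measurable-resp ((λ {ω} → to {ω}) , (λ {ω} → from {ω}))
          (measurable ((X≤c ∩ᵉ levelEvent ψ v) ∪ᵉ (∁ᵉ X≤c ∩ᵉ constᵉ (c ≟ v))))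
          where
          to : ∀ {ω} → (X ω ≤ c × fun ψ ω ≡ v) ⊎ (¬ X ω ≤ c × c ≡ v) → next ω ≡ v
          to {ω} with X ω ≤? c
          ... | yes X≤c = λ { (inj₁ (_ , e)) → e ; (inj₂ (X≰c , _)) → contradiction X≤c X≰c }
          ... | no  X≰c = λ { (inj₁ (X≤c , _)) → contradiction X≤c X≰c ; (inj₂ (_ , e)) → e }
          from : ∀ {ω} → next ω ≡ v → (X ω ≤ c × fun ψ ω ≡ v) ⊎ (¬ X ω ≤ c × c ≡ v)
          from {ω} with X ω ≤? c
          ... | yes X≤c = λ e → inj₁ (X≤c , e)
          ... | no  X≰c = λ e → inj₂ (X≰c , e)

      approximate : ∀ K → Σ[ φ ∈ SimpleFunction ]
        (∀ ω → fun φ ω ≤ X ω) × (∀ ω → X ω ≤ fun φ ω + δ ⊎ K ≤ fun φ ω)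
      approximate K with archimedean (δ ⁻¹ * K)
      ... | m , K/δ<m = φ s , below s , λ ω → close-K ω (close s ω)
        where
        s = staircase m
        K≤step : K ≤ step m
        K≤step = subst₂ _≤_ (x*[x⁻¹*y]≡y K 0<δ) (*-comm δ _) (*-monoʳ-≤ (proj₁ 0<δ) (proj₁ K/δ<m))
        close-K : ∀ ω → X ω ≤ fun (φ s) ω + δ ⊎ step m ≤ fun (φ s) ω → X ω ≤ fun (φ s) ω + δ ⊎ K ≤ fun (φ s) ω
        close-K ω (inj₁ p) = inj₁ p
        close-K ω (inj₂ p) = inj₂ (≤-trans K≤step p)

    -- Lower bounds for weighted sums of expectations

    record Term : Set where
      field
        weight         : ℝ
        0<weight       : 0# < weight
        randomVariable      : Ω → ℝ
        isRandomVariable    : IsRandomVariable randomVariable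
        0≤randomVariable        : ∀ ω → 0# ≤ randomVariable ω
        expectation    : ℝ
        hasExpectation : HasExpectation randomVariable expectation

    open Term

    weightedSum : List Term → Ω → ℝ
    weightedSum ts ω = foldr (λ t acc → weight t * randomVariable t ω + acc) 0# ts

    weightedExpectation : List Term → ℝ
    weightedExpectation = foldr (λ t acc → weight t * expectation t + acc) 0#

    totalWeight : List Term → ℝ
    totalWeight = foldr (λ t acc → weight t + acc) 0#

    0≤totalWeight : ∀ ts → 0# ≤ totalWeight ts
    0≤totalWeight []       = ≤-refl
    0≤totalWeight (t ∷ ts) = 0≤+ (proj₁ (0<weight t)) (0≤totalWeight ts)

    module Discretisation (C δ : ℝ) (0<δ : 0# < δ) where

      -- Capping at C / weight is harmless: a term that reaches its cap
      -- contributes C on its own.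
      approximation : (t : Term) → Σ[ φ ∈ SimpleFunction ] (∀ ω → fun φ ω ≤ randomVariable t ω)
        × (∀ ω → randomVariable t ω ≤ fun φ ω + δ ⊎ weight t ⁻¹ * C ≤ fun φ ω)
      approximation t = Staircase.approximate (randomVariable t) (isRandomVariable t) (0≤randomVariable t) δ 0<δ (weight t ⁻¹ * C)

      approx : Term → SimpleFunction
      approx t = proj₁ (approximation t)

      approximations : List Term → List (ℝ × SimpleFunction)
      approximations = map (λ t → weight t , approx t)

      0≤combination : ∀ ts ω → 0# ≤ combination (approximations ts) ω
      0≤combination []       ω = ≤-refl
      0≤combination (t ∷ ts) ω = 0≤+ (*-nonneg (proj₁ (0<weight t)) (nonneg (approx t) ω)) (0≤combination ts ω)

      -- Either some term reaches its cap and contributes `C` alone, or every term is within `δ` and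
      -- the errors add up with the weights.
      pointwise : ∀ ts ω → C ≤ combination (approximations ts) ω
                         ⊎ weightedSum ts ω ≤ combination (approximations ts) ω + totalWeight ts * δ
      pointwise []       ω = inj₂ (≤-reflexive (sym (trans (+-identityˡ _) (zeroˡ δ))))
      pointwise (t ∷ ts) ω with proj₂ (proj₂ (approximation t)) ω | pointwise ts ω
      ... | inj₂ cap≤ | _ = inj₁ (≤-trans
                (subst (_≤ weight t * fun (approx t) ω) (x*[x⁻¹*y]≡y C (0<weight t)) (*-monoʳ-≤ (proj₁ (0<weight t)) cap≤))
                (x≤x+y _ (0≤combination ts ω)))
      ... | inj₁ _ | inj₁ C≤ = inj₁ (≤-trans C≤ (x≤y+x _ (*-nonneg (proj₁ (0<weight t)) (nonneg (approx t) ω))))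
      ... | inj₁ X≤ | inj₂ IH = inj₂ (≤-trans (+-mono-≤ (*-monoʳ-≤ (proj₁ (0<weight t)) X≤) IH)
                (≤-reflexive (solve 5 (λ w f d c v → w :* (f :+ d) :+ (c :+ v :* d) := (w :* f :+ c) :+ (w :+ v) :* d) refl
                  (weight t) (fun (approx t) ω) δ (combination (approximations ts) ω) (totalWeight ts))))

      integral≤ : ∀ ts → combinationIntegral (approximations ts) ≤ weightedExpectation ts
      integral≤ []       = ≤-refl
      integral≤ (t ∷ ts) = +-mono-≤ (*-monoʳ-≤ (proj₁ (0<weight t))
        (proj₁ (hasExpectation t) _ (approx t , proj₁ (proj₂ (approximation t)) , refl))) (integral≤ ts)

      lower-up-to-δ : ∀ ts → (∀ ω → C ≤ weightedSum ts ω) → C ≤ weightedExpectation ts + totalWeight ts * δ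
      lower-up-to-δ ts C≤ = +-cancelʳ-≤ (- W) (begin
        C - W                                    ≤⟨ combination-lower (approximations ts) (C - W) bound ⟩
        combinationIntegral (approximations ts)  ≤⟨ integral≤ ts ⟩
        weightedExpectation ts                   ≡⟨ m+n-n≡m _ W ⟨
        weightedExpectation ts + W - W           ∎)
        where
        open ≤-R
        W = totalWeight ts * δ
        0≤W : 0# ≤ W
        0≤W = *-nonneg (0≤totalWeight ts) (proj₁ 0<δ)
        C≤+W : ∀ ω → C ≤ combination (approximations ts) ω + W
        C≤+W ω with pointwise ts ω
        ... | inj₁ C≤φ = ≤-trans C≤φ (x≤x+y _ 0≤W)
        ... | inj₂ X≤  = ≤-trans (C≤ ω) X≤
        bound : ∀ ω → C - W ≤ combination (approximations ts) ω
        bound ω = subst (C - W ≤_) (m+n-n≡m _ W) (+-monoˡ-≤ (- W) (C≤+W ω))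

    -- The substitute for linearity of expectation. A shortfall `d` would contradict the approximate
    -- bound as soon as the total error is below `d`.
    weightedExpectation-lower : ∀ ts C → (∀ ω → C ≤ weightedSum ts ω) → C ≤ weightedExpectation ts
    weightedExpectation-lower ts C C≤ with C ≤? weightedExpectation ts
    ... | yes C≤E = C≤E
    ... | no  C≰E with ≤⇒∃+ (proj₁ (≰⇒> C≰E))
    ...   | d , 0≤d , refl = contradiction (Discretisation.lower-up-to-δ C δ 0<δ ts C≤) (<⇒≱ too-small)
      where
      E = weightedExpectation ts
      W = totalWeight ts
      0<d : 0# < d
      0<d = 0≤d , λ { refl → C≰E (≤-reflexive (+-identityʳ E)) }
      0<1+W : 0# < 1# + W
      0<1+W = <-≤-trans 0<1 (x≤x+y 1# (0≤totalWeight ts))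
      -- The summand `1#` keeps the divisor positive even for total weight zero and makes
      -- `W * δ < d` strict.
      δ : ℝ
      δ = (1# + W) ⁻¹ * d
      0<δ : 0# < δ
      0<δ = *-pos (0<⁻¹ 0<1+W) 0<d
      too-small : E + W * δ < E + d
      too-small = subst₂ _<_ (+-comm _ E) (+-comm _ E) (+-monoˡ-< E (begin-strict
        W * δ           ≡⟨ +-identityˡ _ ⟨
        0# + W * δ      <⟨ +-monoˡ-< (W * δ) 0<δ ⟩
        δ + W * δ       ≡⟨ cong (_+ W * δ) (*-identityˡ δ) ⟨
        1# * δ + W * δ  ≡⟨ distribʳ δ 1# W ⟨
        (1# + W) * δ    ≡⟨ x*[x⁻¹*y]≡y d 0<1+W ⟩
        d               ∎))
        where open ≤-R

  -- Conditionals, finite sums and counts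

  open CommutativeMonoidSum (CommutativeRing.+-commutativeMonoid commutativeRing) using (∑-distrib-+; sum-replicate)

  if-yes : ∀ {P A : Set} (P? : Dec P) {x y : A} → P → (if does P? then x else y) ≡ x
  if-yes (yes _) _ = refl
  if-yes (no ¬p) p = contradiction p ¬p

  if-no : ∀ {P A : Set} (P? : Dec P) {x y : A} → ¬ P → (if does P? then x else y) ≡ y
  if-no (yes p) ¬p = contradiction p ¬p
  if-no (no _)  _  = refl

  if-just : ∀ {P A : Set} (P? : Dec P) {x y : A} → (if does P? then just x else nothing) ≡ just y → P × y ≡ x
  if-just (yes p) refl = p , refl

  if-≤ : ∀ {P : Set} (P? : Dec P) {x y z : ℝ} → (P → x ≤ z) → y ≤ z → (if does P? then x else y) ≤ z
  if-≤ (yes p) x≤z _   = x≤z p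
  if-≤ (no  _) _   y≤z = y≤z

  ≤-if : ∀ {P : Set} (P? : Dec P) {x y z : ℝ} → z ≤ x → z ≤ y → z ≤ (if does P? then x else y)
  ≤-if (yes _) z≤x _   = z≤x
  ≤-if (no  _) _   z≤y = z≤y

  sum-mono-≤ : ∀ n {f g : Fin n → ℝ} → (∀ i → f i ≤ g i) → sum f ≤ sum g
  sum-mono-≤ zero    f≤g = ≤-refl
  sum-mono-≤ (suc n) f≤g = +-mono-≤ (f≤g Fin.zero) (sum-mono-≤ n (f≤g ∘ Fin.suc))

  sum-nonneg : ∀ n {f : Fin n → ℝ} → (∀ i → 0# ≤ f i) → 0# ≤ sum f
  sum-nonneg zero    0≤f = ≤-refl
  sum-nonneg (suc n) 0≤f = 0≤+ (0≤f Fin.zero) (sum-nonneg n (0≤f ∘ Fin.suc))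

  sum-indicator : ∀ {A : Set} {P : A → Set} (P? : Decidable P) n (f : Fin n → A) x →
    sum (λ i → if does (P? (f i)) then x else 0#) ≡ length (filter P? (List.tabulate f)) · x
  sum-indicator P? zero    f x = refl
  sum-indicator P? (suc n) f x with P? (f Fin.zero)
  ... | yes _ = cong (x +_) (sum-indicator P? n (f ∘ Fin.suc) x)
  ... | no  _ = trans (+-identityˡ _) (sum-indicator P? n (f ∘ Fin.suc) x)

  count : ∀ {n} {P : Fin n → Set} → Decidable P → ℕ
  count {n} P? = length (filter P? (allFin n))

  count-⊆ : ∀ {n} {P : Fin n → Set} (P? : Decidable P) {A : Set} (h : Fin n → A) (ys : List A) →
    (∀ {i j} → h i ≡ h j → i ≡ j) → (∀ i → P i → h i ∈ ys) → count P? ℕ.≤ length ys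
  count-⊆ {n} P? h ys inj P⇒∈ = subst (ℕ._≤ length ys) (length-map h (filter P? (allFin n)))
    (unique-⊆⇒length≤ (Uniqueₚ.map⁺ inj (Uniqueₚ.filter⁺ P? (Uniqueₚ.allFin⁺ n))) ⊆ys)
    where
    ⊆ys : map h (filter P? (allFin n)) ⊆ ys
    ⊆ys z∈ with ∈-map⁻ h z∈
    ... | i , i∈ , refl = P⇒∈ i (proj₂ (∈-filter⁻ P? {xs = allFin n} i∈))

  count-mono : ∀ {n} {P Q : Fin n → Set} (P? : Decidable P) (Q? : Decidable Q) →
    (∀ i → P i → Q i) → count P? ℕ.≤ count Q?
  count-mono {n} P? Q? P⇒Q = count-⊆ P? id (filter Q? (allFin n)) id (λ i p → ∈-filter⁺ Q? (∈-allFin i) (P⇒Q i p))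

  -- Estimates for integrals of step functions

  ∫-nonneg : ∀ {f t} (s : StepFunction f t) → 0# ≤ ∫ s
  ∫-nonneg (vanish _)          = ≤-refl
  ∫-nonneg {f} {t} (piece _ t<t′ _ s)  = 0≤+ (*-nonneg (0≤fromℕ (f t)) (x≤y⇒0≤y-x (proj₁ t<t′))) (∫-nonneg s)

  -- A piece either covers the window of length `d` or uses up a part `d′` of it. The bound `c` may
  -- be negative, which happens when it is a number of bins minus a migration term.
  ∫-lower : ∀ {f t} (s : StepFunction f t) c d → 0# ≤ d →
    (∀ u → t ≤ u → u < t + d → c ≤ fromℕ (f u)) → c * d ≤ ∫ s
  ∫-lower {f} {t} s c d 0≤d c≤f with d ≟ 0#
  -- An empty window does not even contain `t`, so it says nothing about `c`.
  ... | yes refl = subst (_≤ ∫ s) (sym (zeroʳ c)) (∫-nonneg s)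
  ... | no  d≢0  = go s
    where
    c≤ft : c ≤ fromℕ (f t)
    c≤ft = c≤f t ≤-refl (x≤x+y t 0≤d , λ e → d≢0 (+-cancelʳ-≡ t (trans (+-comm d t) (trans (sym e) (sym (+-identityˡ t))))))
    go : (s : StepFunction f t) → c * d ≤ ∫ s
    go (vanish f≡0) = subst (c * d ≤_) (zeroˡ d)
      (*-monoˡ-≤ 0≤d (subst (λ m → c ≤ fromℕ m) (f≡0 t ≤-refl) c≤ft))
    go (piece t′ t<t′ _ rest) with ≤⇒∃+ (proj₁ t<t′)
    ... | d′ , 0≤d′ , refl with d ≤? d′
    ...   | yes d≤d′ = begin
      c * d                                      ≤⟨ *-monoˡ-≤ 0≤d c≤ft ⟩
      fromℕ (f t) * d                            ≤⟨ *-monoʳ-≤ (0≤fromℕ (f t)) d≤d′ ⟩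
      fromℕ (f t) * d′                           ≡⟨ cong (fromℕ (f t) *_) ([m+n]-m≡n t d′) ⟨
      fromℕ (f t) * (t + d′ - t)                 ≤⟨ x≤x+y _ (∫-nonneg rest) ⟩
      fromℕ (f t) * (t + d′ - t) + ∫ rest        ∎
      where open ≤-R
    ...   | no d≰d′ with ≤⇒∃+ (proj₁ (≰⇒> d≰d′))
    ...     | d″ , 0≤d″ , refl = begin
      c * (d′ + d″)                              ≡⟨ distribˡ c d′ d″ ⟩
      c * d′ + c * d″                            ≤⟨ +-mono-≤ (*-monoˡ-≤ 0≤d′ c≤ft) (∫-lower rest c d″ 0≤d″ c≤f′) ⟩
      fromℕ (f t) * d′ + ∫ rest                  ≡⟨ cong (λ x → fromℕ (f t) * x + ∫ rest) ([m+n]-m≡n t d′) ⟨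
      fromℕ (f t) * (t + d′ - t) + ∫ rest        ∎
      where
      open ≤-R
      c≤f′ : ∀ u → t + d′ ≤ u → u < t + d′ + d″ → c ≤ fromℕ (f u)
      c≤f′ u t′≤u u< = c≤f u (≤-trans (x≤x+y t 0≤d′) t′≤u) (subst (u <_) (+-assoc t d′ d″) u<)

  ∫-upper : ∀ {f t} (s : StepFunction f t) m d → 0# ≤ d →
    (∀ u → f u ℕ.≤ m) → (∀ u → t + d ≤ u → f u ≡ 0) → ∫ s ≤ fromℕ m * d
  ∫-upper (vanish _) m d 0≤d _ _ = *-nonneg (0≤fromℕ m) 0≤d
  ∫-upper {f} {t} (piece t′ t<t′ const rest) m d 0≤d f≤m f≡0 with ≤⇒∃+ (proj₁ t<t′)
  ... | d′ , 0≤d′ , refl with d′ ≤? d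
  ...   | yes d′≤d with ≤⇒∃+ d′≤d
  ...     | d″ , 0≤d″ , refl = begin
    fromℕ (f t) * (t + d′ - t) + ∫ rest          ≡⟨ cong (λ x → fromℕ (f t) * x + ∫ rest) ([m+n]-m≡n t d′) ⟩
    fromℕ (f t) * d′ + ∫ rest                    ≤⟨ +-mono-≤ (*-monoˡ-≤ 0≤d′ (fromℕ-mono-≤ (f≤m t)))
                                                      (∫-upper rest m d″ 0≤d″ f≤m (λ u p → f≡0 u (subst (_≤ u) (+-assoc t d′ d″) p))) ⟩
    fromℕ m * d′ + fromℕ m * d″                  ≡⟨ distribˡ (fromℕ m) d′ d″ ⟨
    fromℕ m * (d′ + d″)                          ∎
    where open ≤-R
  ∫-upper {f} {t} (piece t′ t<t′ const rest) m d 0≤d f≤m f≡0 | d′ , 0≤d′ , refl | no d′≰d = begin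
    fromℕ (f t) * (t + d′ - t) + ∫ rest          ≡⟨ cong (λ x → fromℕ x * (t + d′ - t) + ∫ rest) ft≡0 ⟩
    0# * (t + d′ - t) + ∫ rest                   ≡⟨ trans (cong (_+ ∫ rest) (zeroˡ _)) (+-identityˡ _) ⟩
    ∫ rest                                       ≤⟨ ∫-upper rest m 0# ≤-refl f≤m (λ u p → f≡0 u (≤-trans t+d≤t′ (subst (_≤ u) (+-identityʳ _) p))) ⟩
    fromℕ m * 0#                                 ≤⟨ *-monoʳ-≤ (0≤fromℕ m) 0≤d ⟩
    fromℕ m * d                                  ∎
    where
    open ≤-R
    d<d′ : d < d′
    d<d′ = ≰⇒> d′≰d
    t+d≤t′ : t + d ≤ t + d′
    t+d≤t′ = +-monoʳ-≤ t (proj₁ d<d′)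
    -- The piece extends beyond `t + d`, where `f` already vanishes, so its constant value is zero.
    ft≡0 : f t ≡ 0
    ft≡0 = trans (sym (const (t + d) (x≤x+y t 0≤d) (subst₂ _<_ (+-comm d t) (+-comm d′ t) (+-monoˡ-< t d<d′))))
                 (f≡0 (t + d) ≤-refl)

  ∈-nonemptyBins : ∀ {n} (c : Fin n → Maybe ℕ) {i b} → c i ≡ just b → b ∈ catMaybes (List.tabulate c)
  ∈-nonemptyBins c {i} c≡ = ∈-catMaybes⁺ (subst (_∈ List.tabulate c) c≡ (∈-tabulate⁺ i))

  nonemptyBins-∈ : ∀ {n} (c : Fin n → Maybe ℕ) {b} → b ∈ catMaybes (List.tabulate c) → ∃[ i ] c i ≡ just b
  nonemptyBins-∈ c b∈ with ∈-tabulate⁻ (∈-catMaybes⁻ (List.tabulate c) b∈)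
  ... | i , e = i , sym e

  -- The instances of the adversary

  module Adversary (k : ℕ) .{{k≢0 : NonZero k}} where

    n : ℕ
    n = k ℕ.* k

    open DecMembership (Finₚ._≟_ {n}) using (_∈?_)

    1≤k : 1 ℕ.≤ k
    1≤k = ℕ.>-nonZero⁻¹ k

    K s μ : ℝ
    K = fromℕ k
    s = K ⁻¹
    μ = fromℕ (suc n)

    0<K : 0# < K
    0<K = fromℕ-mono-< 1≤k

    0≤s : 0# ≤ s
    0≤s = proj₁ (0<⁻¹ 0<K)

    K*s≡1 : K * s ≡ 1#
    K*s≡1 = trans (*-comm K s) (*-inverseˡ 0<K)

    s≤1 : s ≤ 1#
    s≤1 = *-cancelˡ-≤ 0<K (subst₂ _≤_ (trans fromℕ-1 (sym K*s≡1)) (sym (*-identityʳ K)) (fromℕ-mono-≤ 1≤k))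

    1<μ : 1# < μ
    1<μ = subst (_< μ) fromℕ-1 (fromℕ-mono-< (ℕ.s≤s (ℕₚ.*-mono-≤ 1≤k 1≤k)))

    0<μ : 0# < μ
    0<μ = ≤-<-trans 0≤1 1<μ

    -- The list matters only through its entries: an item drawn twice is a single survivor.
    lifetime : List (Fin n) → Fin n → ℝ
    lifetime xs i = if does (i ∈? xs) then μ else 1#

    1≤lifetime : ∀ xs i → 1# ≤ lifetime xs i
    1≤lifetime xs i = ≤-if (i ∈? xs) (proj₁ 1<μ) ≤-refl

    lifetime≤μ : ∀ xs i → lifetime xs i ≤ μ
    lifetime≤μ xs i = if-≤ (i ∈? xs) (λ _ → ≤-refl) (proj₁ 1<μ)

    lifetime-∈ : ∀ {xs i} → i ∈ xs → lifetime xs i ≡ μ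
    lifetime-∈ {xs} {i} i∈ = if-yes (i ∈? xs) i∈

    inst : List (Fin n) → Instance
    inst xs = record
      { #items = n
      ; item   = λ i → record
        { arrival = 0# ; size = s ; duration = lifetime xs i
        ; 0≤arrival = ≤-refl ; 0≤size = 0≤s ; size≤1 = s≤1
        ; 0<duration = <-≤-trans 0<1 (1≤lifetime xs i) }
      ; sorted = λ _ _ _ → ≤-refl
      }

    open Instance
    open Item

    present : ∀ xs i {t} → 0# ≤ t → t < lifetime xs i → Present (item (inst xs) i) t
    present xs i {t} 0≤t t< = 0≤t , subst (t <_) (sym (+-identityˡ _)) t<

    present⇒< : ∀ xs i {t} → Present (item (inst xs) i) t → t < lifetime xs i
    present⇒< xs i {t} (_ , t<) = subst (t <_) (+-identityˡ _) t<

    totalSize≡K : ∀ xs → totalSize (inst xs) ≡ K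
    totalSize≡K xs = begin
      sum {n} (λ _ → s)       ≡⟨ sum-replicate n ⟩
      n · s                   ≡⟨ ·≡fromℕ* n s ⟩
      fromℕ n * s             ≡⟨ cong (_* s) (fromℕ-* k k) ⟩
      K * K * s               ≡⟨ *-assoc K K s ⟩
      K * (K * s)             ≡⟨ cong (K *_) K*s≡1 ⟩
      K * 1#                  ≡⟨ *-identityʳ K ⟩
      K                       ∎
      where open ≡-Reasoning

    inBin? : (c : Fin n → Maybe ℕ) (b : ℕ) → Decidable (λ i → c i ≡ just b)
    inBin? c b i = ≡-dec ℕₚ._≟_ (c i) (just b)

    load≡ : ∀ xs c b → load (inst xs) c b ≡ fromℕ (count (inBin? c b)) * s
    load≡ xs c b = trans (sum-indicator (inBin? c b) n id s) (·≡fromℕ* (count (inBin? c b)) s)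

    fits : ∀ xs c b → count (inBin? c b) ℕ.≤ k → load (inst xs) c b ≤ 1#
    fits xs c b ≤k = subst₂ _≤_ (sym (load≡ xs c b)) K*s≡1 (*-monoˡ-≤ 0≤s (fromℕ-mono-≤ ≤k))

    fits⁻¹ : ∀ xs c b → load (inst xs) c b ≤ 1# → count (inBin? c b) ℕ.≤ k
    fits⁻¹ xs c b load≤1 = fromℕ-cancel-≤ (*-cancelˡ-≤ (0<⁻¹ 0<K)
      (subst₂ _≤_ (trans (load≡ xs c b) (*-comm _ s)) (trans (sym K*s≡1) (*-comm K s)) load≤1))

    fibre≤k : ∀ xs c (f : Fin n → ℕ) → (∀ i → c i ≡ just (f i)) → WithinCapacity (inst xs) c →
      ∀ b → count (λ i → f i ℕₚ.≟ b) ℕ.≤ k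
    fibre≤k xs c f c≡ cap b = ℕₚ.≤-trans
      (count-mono _ (inBin? c b) (λ i fi≡b → trans (c≡ i) (cong just fi≡b))) (fits⁻¹ xs c b (cap b))

    bins≥k : ∀ xs c (f : Fin n → ℕ) → (∀ i → c i ≡ just (f i)) → WithinCapacity (inst xs) c →
      k ℕ.≤ nonemptyBins (inst xs) c
    bins≥k xs c f c≡ cap = ℕₚ.*-cancelʳ-≤ k _ k (subst (ℕ._≤ nonemptyBins (inst xs) c ℕ.* k) (length-tabulate {n = n} id)
      (Fibres.length≤*bins (allFin n) f k (fibre≤k xs c f c≡ cap) (List.deduplicate ℕₚ._≟_ (catMaybes (List.tabulate c)))
        (λ i → ∈-deduplicate⁺ ℕₚ._≟_ (∈-nonemptyBins c (c≡ i)))))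

    -- The optimum of these instances

    optAt : ℝ → ℕ
    optAt t = if does (t <? 1#) then k else if does (t <? μ) then 1 else 0

    optAt-early : ∀ {t} → t < 1# → optAt t ≡ k
    optAt-early {t} t<1 = if-yes (t <? 1#) t<1

    optAt-late : ∀ {t} → 1# ≤ t → t < μ → optAt t ≡ 1
    optAt-late {t} 1≤t t<μ = trans (if-no (t <? 1#) (λ t<1 → <⇒≱ t<1 1≤t)) (if-yes (t <? μ) t<μ)

    optAt-over : ∀ {t} → μ ≤ t → optAt t ≡ 0
    optAt-over {t} μ≤t = trans (if-no (t <? 1#) (λ t<1 → <⇒≱ t<1 (≤-trans (proj₁ 1<μ) μ≤t)))
      (if-no (t <? μ) (λ t<μ → <⇒≱ t<μ μ≤t))

    opt-early : ∀ xs t → 0# ≤ t → t < 1# → IsOPTAt (inst xs) t k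
    opt-early xs t 0≤t t<1 = (c , packing , ℕₚ.≤-antisym c≤k (lower c packing)) , lower
      where
      here! : ∀ i → Present (item (inst xs) i) t
      here! i = present xs i 0≤t (<-≤-trans t<1 (1≤lifetime xs i))
      c : Configuration (inst xs)
      c i = just (toℕ i / k)
      packing : IsPackingAt (inst xs) t c
      packing = (λ i _ → _ , refl) , (λ i _ _ → here! i) , λ b → fits xs c b (ℕₚ.≤-trans
        (count-mono (inBin? c b) (λ i → toℕ i / k ℕₚ.≟ b) (λ i e → just-injective e)) (quotient-fibre k n b))
      c⊆ : catMaybes (List.tabulate c) ⊆ upTo k
      c⊆ b∈ with nonemptyBins-∈ c b∈
      ... | i , refl = ∈-upTo⁺ (m<n*o⇒m/o<n (Finₚ.toℕ<n i))
      c≤k : nonemptyBins (inst xs) c ℕ.≤ k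
      c≤k = subst (nonemptyBins (inst xs) c ℕ.≤_) (length-upTo k) (#distinct-⊆ c⊆)
      lower : ∀ c → IsPackingAt (inst xs) t c → k ℕ.≤ nonemptyBins (inst xs) c
      lower c (placed , _ , cap) = bins≥k xs c (λ i → proj₁ (placed i (here! i))) (λ i → proj₂ (placed i (here! i))) cap

    -- At most `k` survivors fit into one bin, and the entry `x` ensures that there is a survivor to
    -- pack.
    opt-late : ∀ x xs t → length (x ∷ xs) ℕ.≤ k → 1# ≤ t → t < μ → IsOPTAt (inst (x ∷ xs)) t 1
    opt-late x xs′ t len≤k 1≤t t<μ = (c , packing , ℕₚ.≤-antisym (#distinct-⊆ c⊆) (lower c packing)) , lower
      where
      xs = x ∷ xs′
      0≤t : 0# ≤ t
      0≤t = ≤-trans 0≤1 1≤t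
      here! : ∀ {i} → i ∈ xs → Present (item (inst xs) i) t
      here! {i} i∈ = present xs i 0≤t (subst (t <_) (sym (lifetime-∈ i∈)) t<μ)
      survives : ∀ i → Present (item (inst xs) i) t → i ∈ xs
      survives i p with i ∈? xs
      ... | yes i∈ = i∈
      ... | no  i∉ = contradiction 1≤t (<⇒≱ (subst (t <_) (if-no (i ∈? xs) i∉) (present⇒< xs i p)))
      c : Configuration (inst xs)
      c i = if does (i ∈? xs) then just 0 else nothing
      c-just : ∀ i {b} → c i ≡ just b → i ∈ xs × b ≡ 0
      c-just i = if-just (i ∈? xs)
      c-∈ : ∀ {i} → i ∈ xs → c i ≡ just 0
      c-∈ {i} i∈ = if-yes (i ∈? xs) i∈
      packing : IsPackingAt (inst xs) t c
      packing = (λ i p → 0 , c-∈ (survives i p)) , (λ i b e → here! (proj₁ (c-just i e)))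
        , λ b → fits xs c b (ℕₚ.≤-trans (count-⊆ (inBin? c b) id xs id (λ i e → proj₁ (c-just i e))) len≤k)
      c⊆ : catMaybes (List.tabulate c) ⊆ 0 ∷ []
      c⊆ b∈ with nonemptyBins-∈ c b∈
      ... | i , e = here (proj₂ (c-just i e))
      lower : ∀ c → IsPackingAt (inst xs) t c → 1 ℕ.≤ nonemptyBins (inst xs) c
      lower c (placed , _ , _) = nonempty (∈-deduplicate⁺ ℕₚ._≟_ (∈-nonemptyBins c (proj₂ (placed x (here! (here refl))))))
        where
        nonempty : ∀ {y : ℕ} {ys} → y ∈ ys → 1 ℕ.≤ length ys
        nonempty {ys = _ ∷ _} _ = ℕ.s≤s ℕ.z≤n

    opt-over : ∀ xs t → μ ≤ t → IsOPTAt (inst xs) t 0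
    opt-over xs t μ≤t = (c , packing , ℕₚ.n≤0⇒n≡0 (#distinct-⊆ {ys = []} c⊆)) , λ _ _ → ℕ.z≤n
      where
      gone : ∀ i → ¬ Present (item (inst xs) i) t
      gone i p = <⇒≱ (<-≤-trans (present⇒< xs i p) (lifetime≤μ xs i)) μ≤t
      c : Configuration (inst xs)
      c _ = nothing
      packing : IsPackingAt (inst xs) t c
      packing = (λ i p → contradiction p (gone i)) , (λ _ _ ()) , λ b → fits xs c b
        (ℕₚ.≤-trans (count-⊆ (inBin? c b) id [] id (λ _ ())) ℕ.z≤n)
      c⊆ : catMaybes (List.tabulate c) ⊆ []
      c⊆ b∈ with nonemptyBins-∈ c b∈
      ... | _ , ()

    OPT : ℝ
    OPT = fromℕ (k ℕ.+ n)

    isOPT : ∀ x xs → length (x ∷ xs) ℕ.≤ k → IsOPT (inst (x ∷ xs)) OPT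
    isOPT x xs len≤k = optAt , at , steps , sym ∫≡
      where
      at : ∀ t → 0# ≤ t → IsOPTAt (inst (x ∷ xs)) t (optAt t)
      at t 0≤t = by-phase (t <? 1#) (t <? μ)
        where
        by-phase : Dec (t < 1#) → Dec (t < μ) → IsOPTAt (inst (x ∷ xs)) t (optAt t)
        by-phase (yes t<1) _         = subst (IsOPTAt (inst (x ∷ xs)) t) (sym (optAt-early t<1)) (opt-early (x ∷ xs) t 0≤t t<1)
        by-phase (no  t≮1) (yes t<μ) = subst (IsOPTAt (inst (x ∷ xs)) t) (sym (optAt-late (≮⇒≥ t≮1) t<μ)) (opt-late x xs t len≤k (≮⇒≥ t≮1) t<μ)
        by-phase (no  _)   (no  t≮μ) = subst (IsOPTAt (inst (x ∷ xs)) t) (sym (optAt-over (≮⇒≥ t≮μ))) (opt-over (x ∷ xs) t (≮⇒≥ t≮μ))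
      steps : StepFunction optAt 0#
      steps = piece 1# 0<1 (λ u _ u<1 → trans (optAt-early u<1) (sym (optAt-early 0<1)))
        (piece μ 1<μ (λ u 1≤u u<μ → trans (optAt-late 1≤u u<μ) (sym (optAt-late ≤-refl 1<μ)))
          (vanish (λ u μ≤u → optAt-over μ≤u)))
      ∫≡ : ∫ steps ≡ OPT
      ∫≡ = begin
        fromℕ (optAt 0#) * (1# - 0#) + (fromℕ (optAt 1#) * (μ - 1#) + 0#)
          ≡⟨ cong₂ (λ a b → fromℕ a * (1# - 0#) + (fromℕ b * (μ - 1#) + 0#)) (optAt-early 0<1) (optAt-late ≤-refl 1<μ) ⟩
        K * (1# - 0#) + (fromℕ 1 * (μ - 1#) + 0#)
          ≡⟨ cong₂ _+_ (trans (cong (K *_) (trans (cong (_- 0#) (sym (+-identityʳ 1#))) (m+n-n≡m 1# 0#))) (*-identityʳ K))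
               (trans (+-identityʳ _) (trans (cong₂ _*_ fromℕ-1 ([m+n]-m≡n 1# (fromℕ n))) (*-identityˡ _))) ⟩
        K + fromℕ n
          ≡⟨ fromℕ-+ k n ⟨
        OPT ∎
        where open ≡-Reasoning

    -- Migration along an execution

    module Run (σ : Strategy) where

      module Survivors (xs : List (Fin n)) where

        I : Instance
        I = inst xs

        bin : ℝ → Fin n → ℕ
        bin u i = σ (historyAt I n u) (toℕ i)

        configuration-present : ∀ u i → Present (item I i) u → configuration σ I n u i ≡ just (bin u i)
        configuration-present u i p =
          if-yes ((toℕ i ℕₚ.<? n) ×-dec ((0# ≤? u) ×-dec (u <? departure (item I i)))) (Finₚ.toℕ<n i , p)

        configuration-∈ : ∀ {u i} → 0# ≤ u → u < μ → i ∈ xs → configuration σ I n u i ≡ just (bin u i)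
        configuration-∈ {u} {i} 0≤u u<μ i∈ =
          configuration-present u i (present xs i 0≤u (subst (u <_) (sym (lifetime-∈ i∈)) u<μ))

        configuration-over : ∀ {u} j → μ ≤ u → ∀ i → configuration σ I j u i ≡ nothing
        configuration-over {u} j μ≤u i =
          if-no ((toℕ i ℕₚ.<? j) ×-dec ((0# ≤? u) ×-dec (u <? departure (item I i))))
            (λ (_ , p) → <⇒≱ (<-≤-trans (present⇒< xs i p) (lifetime≤μ xs i)) μ≤u)

        activeBins≤n : ∀ u → activeBins σ I u ℕ.≤ n
        activeBins≤n u = ℕₚ.≤-trans (length-deduplicate ℕₚ._≟_ (catMaybes (List.tabulate c)))
          (ℕₚ.≤-trans (length-catMaybes (List.tabulate c)) (ℕₚ.≤-reflexive (length-tabulate c)))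
          where c = configuration σ I (#arrived I u) u

        activeBins-over : ∀ u → 0# + μ ≤ u → activeBins σ I u ≡ 0
        activeBins-over u μ≤u = ℕₚ.n≤0⇒n≡0 (#distinct-⊆ {ys = []} ⊆[])
          where
          c = configuration σ I (#arrived I u) u
          ⊆[] : catMaybes (List.tabulate c) ⊆ []
          ⊆[] b∈ with nonemptyBins-∈ c b∈
          ... | i , e with trans (sym (configuration-over (#arrived I u) (subst (_≤ u) (+-identityˡ μ) μ≤u) i)) e
          ... | ()

        #arrived≡n : ∀ {u} → 0# ≤ u → #arrived I u ≡ n
        #arrived≡n {u} 0≤u = trans (cong length (filter-all (λ i → 0# ≤? u) (All.universal (λ _ → 0≤u) (allFin n)))) (length-tabulate {n = n} id)

        moved? : ∀ t u → Decidable (λ i → i ∈ xs × ¬ bin t i ≡ bin u i)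
        moved? t u i = (i ∈? xs) ×-dec ¬? (bin t i ℕₚ.≟ bin u i)

        -- Net displacement between `t` and `u`, counted for survivors only: they stay in bins at
        -- all times in `[0, μ)`, so `movedSize` charges each change of their bin.
        shift : ℝ → ℝ → Fin n → ℝ
        shift t u i = if does (moved? t u i) then s else 0#

        shift-nonneg : ∀ t u i → 0# ≤ shift t u i
        shift-nonneg t u i = ≤-if (moved? t u i) 0≤s ≤-refl

        shift-∈ : ∀ {t u i x} → (i ∈ xs → ¬ bin t i ≡ bin u i → s ≤ x) → 0# ≤ x → shift t u i ≤ x
        shift-∈ {t} {u} {i} s≤x 0≤x = if-≤ (moved? t u i) (λ (i∈ , ≢) → s≤x i∈ ≢) 0≤x

        shift-moved : ∀ {t u i} → i ∈ xs → ¬ bin t i ≡ bin u i → s ≤ shift t u i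
        shift-moved {t} {u} {i} i∈ ≢ = ≤-reflexive (sym (if-yes (moved? t u i) (i∈ , ≢)))

        -- An item whose bins at `t` and `u` differ cannot have both of them equal to its bin at
        -- `t′`.
        shift-triangle : ∀ t t′ u → sum (shift t u) ≤ sum (shift t t′) + sum (shift t′ u)
        shift-triangle t t′ u = ≤-trans (sum-mono-≤ n pointwise) (≤-reflexive (∑-distrib-+ (shift t t′) (shift t′ u)))
          where
          pointwise : ∀ i → shift t u i ≤ shift t t′ i + shift t′ u i
          pointwise i = shift-∈ {t} {u} bound (0≤+ (shift-nonneg t t′ i) (shift-nonneg t′ u i))
            where
            bound : i ∈ xs → ¬ bin t i ≡ bin u i → s ≤ shift t t′ i + shift t′ u i
            bound i∈ ≢ with bin t i ℕₚ.≟ bin t′ i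
            ... | no  t≢t′ = ≤-trans (shift-moved i∈ t≢t′) (x≤x+y _ (shift-nonneg t′ u i))
            ... | yes t≡t′ = ≤-trans (shift-moved i∈ (λ e → ≢ (trans t≡t′ e))) (x≤y+x _ (shift-nonneg t t′ i))

        moved-nonneg : ∀ b b′ → 0# ≤ moved b b′ s
        moved-nonneg nothing  _        = ≤-refl
        moved-nonneg (just _) nothing  = ≤-refl
        moved-nonneg (just b) (just b′) = ≤-if (b ℕₚ.≟ b′) ≤-refl 0≤s

        movedSize-nonneg : ∀ j t j′ t′ → 0# ≤ movedSize I (configuration σ I j t) (configuration σ I j′ t′)
        movedSize-nonneg j t j′ t′ = sum-nonneg n (λ i → moved-nonneg (configuration σ I j t i) (configuration σ I j′ t′ i))

        migratedSize-nonneg : ∀ {j t} (e : Execution σ I j t) → 0# ≤ migratedSize e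
        migratedSize-nonneg (done _ _) = ≤-refl
        migratedSize-nonneg {j} {t} (wait t′ _ _ _ e) = 0≤+ (movedSize-nonneg j t j t′) (migratedSize-nonneg e)
        migratedSize-nonneg {j} {t} (arrive _ e)      = 0≤+ (movedSize-nonneg j t (suc j) t) (migratedSize-nonneg e)

        shift≤movedSize : ∀ {t u} → 0# ≤ t → t < μ → 0# ≤ u → u < μ →
          sum (shift t u) ≤ movedSize I (configuration σ I n t) (configuration σ I n u)
        shift≤movedSize {t} {u} 0≤t t<μ 0≤u u<μ = sum-mono-≤ n (λ i → shift-∈ {t} {u} (bound i) (moved-nonneg (configuration σ I n t i) (configuration σ I n u i)))
          where
          bound : ∀ i → i ∈ xs → ¬ bin t i ≡ bin u i → s ≤ moved (configuration σ I n t i) (configuration σ I n u i) s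
          bound i i∈ ≢ = ≤-reflexive (sym (trans
            (cong₂ (λ b b′ → moved b b′ s) (configuration-∈ 0≤t t<μ i∈) (configuration-∈ 0≤u u<μ i∈))
            (if-no (bin t i ℕₚ.≟ bin u i) ≢)))

        module _ {x} (x∈ : x ∈ xs) where

          -- Net displacement is zero while the configuration is constant, and by the triangle
          -- inequality it accumulates to at most the migrated size.
          migration-after : ∀ {t} (e : Execution σ I n t) → 0# ≤ t → ∀ {u} → t ≤ u → u < μ →
            sum (shift t u) ≤ migratedSize e
          -- The survivor `x` is still present at `u`, so the execution has not ended.
          migration-after (done _ departed) 0≤t t≤u u<μ = contradiction
            (≤-trans (subst (_≤ _) (trans (+-identityˡ _) (lifetime-∈ x∈)) (departed x)) t≤u) (<⇒≱ u<μ)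
          migration-after (arrive (n<n , _) _) _ _ _ = contradiction n<n (ℕₚ.<-irrefl refl)
          migration-after {t} (wait t′ t<t′ _ same e) 0≤t {u} t≤u u<μ with u <? t′
          ... | yes u<t′ = ≤-trans (≤-trans (sum-mono-≤ n (λ i → shift-∈ {t} {u} (still i) ≤-refl))
                  (≤-reflexive sum-0)) (0≤+ (movedSize-nonneg n t n t′) (migratedSize-nonneg e))
            where
            sum-0 : sum {n} (λ _ → 0#) ≡ 0#
            sum-0 = trans (sum-replicate n) (trans (·≡fromℕ* n 0#) (zeroʳ _))
            still : ∀ i → i ∈ xs → ¬ bin t i ≡ bin u i → s ≤ 0#
            still i i∈ ≢ = contradiction (just-injective (trans (sym (configuration-∈ 0≤t (≤-<-trans t≤u u<μ) i∈))
              (trans (sym (same u t≤u u<t′ i)) (configuration-∈ (≤-trans 0≤t t≤u) u<μ i∈)))) ≢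
          ... | no  u≮t′ = ≤-trans (shift-triangle t t′ u) (+-mono-≤
                  (shift≤movedSize 0≤t (≤-<-trans t≤u u<μ) 0≤t′ (≤-<-trans t′≤u u<μ))
                  (migration-after e 0≤t′ t′≤u u<μ))
            where
            t′≤u : t′ ≤ u
            t′≤u = ≮⇒≥ u≮t′
            0≤t′ : 0# ≤ t′
            0≤t′ = ≤-trans 0≤t (proj₁ t<t′)

          -- Displacement is measured from the placement at time 0 with all items revealed; moves
          -- made during the revelation only increase the right-hand side.
          migration : ∀ {j} (e : Execution σ I j 0#) → j ℕ.≤ n → ∀ {u} → 0# ≤ u → u < μ →
            sum (shift 0# u) ≤ migratedSize e
          migration {j} e j≤n 0≤u u<μ with j ℕₚ.≟ n
          ... | yes refl = migration-after e ≤-refl 0≤u u<μ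
          ... | no  j≢n with e
          ...   | done j≡n _ = contradiction j≡n j≢n
          -- The item with index `j` is unrevealed and arrives at 0, so time cannot advance yet.
          ...   | wait t′ 0<t′ (_ , _ , _ , t′≤) _ _ =
            contradiction (t′≤ (fromℕ< j<n) (ℕₚ.≤-reflexive (sym (Finₚ.toℕ-fromℕ< j<n)))) (<⇒≱ 0<t′)
            where
            j<n : j ℕ.< n
            j<n = ℕₚ.≤∧≢⇒< j≤n j≢n
          ...   | arrive (j<n , _) e′ = ≤-trans (migration e′ j<n 0≤u u<μ) (x≤y+x _ (movedSize-nonneg j 0# (suc j) 0#))

      -- At time 0 no departure has been observed yet, so the placement of the
      -- items does not depend on the set of survivors.
      initialHistory : History
      initialHistory = history 0# (take n (List.tabulate {n = n} (λ _ → observation 0# s nothing)))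

      initialBin : Fin n → ℕ
      initialBin i = σ initialHistory (toℕ i)

      history-initial : ∀ xs → historyAt (inst xs) n 0# ≡ initialHistory
      history-initial xs = cong (λ obs → history 0# (take n obs)) (tabulate-cong observe≡)
        where
        observe≡ : ∀ i → observe 0# (item (inst xs) i) ≡ observation 0# s nothing
        observe≡ i = cong (observation 0# s) (if-no (departure (item (inst xs) i) ≤? 0#)
          (λ d≤0 → <⇒≱ (<-≤-trans 0<1 (1≤lifetime xs i)) (subst (_≤ 0#) (+-identityˡ _) d≤0)))

      bin-initial : ∀ xs i → Survivors.bin xs 0# i ≡ initialBin i
      bin-initial xs i = cong (λ h → σ h (toℕ i)) (history-initial xs)

      -- The initial placement is the same for all lists of survivors, so capacity can be read off
      -- from `inst []`.
      initialBin-fibre : IsFeasible σ → ∀ b → count (λ i → initialBin i ℕₚ.≟ b) ℕ.≤ k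
      initialBin-fibre feasible = fibre≤k [] (configuration σ (inst []) n 0#) initialBin
        (λ i → trans (Survivors.configuration-present [] 0# i (present [] i ≤-refl (<-≤-trans 0<1 (1≤lifetime [] i))))
                     (cong just (bin-initial [] i)))
        (feasible (inst []) n 0# (ℕₚ.≤-refl , ≤-refl , (λ _ _ → ≤-refl) , (λ _ _ → ≤-refl)))

      -- Survivor bins bounded by migration and cost

      module _ {x} xs (x∈ : x ∈ xs) (e : Execution σ (inst xs) 0 0#) where
        open Survivors xs

        -- A survivor that has not moved keeps its initial bin nonempty at `u`. Every other one has
        -- contributed `s = 1 / k` to the migrated size, hence 1 to `K * migratedSize e`.
        distinct≤ : ∀ {u} → 0# ≤ u → u < μ → fromℕ (#distinct (map initialBin xs)) ≤ K * migratedSize e + fromℕ (activeBins σ I u)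
        distinct≤ {u} 0≤u u<μ = begin
          fromℕ (#distinct (map initialBin xs))
            ≤⟨ fromℕ-mono-≤ (#distinct-⊆-++ (map initialBin shifted) (catMaybes (List.tabulate c)) covered) ⟩
          fromℕ (length (map initialBin shifted) ℕ.+ nonemptyBins I c)
            ≡⟨ fromℕ-+ (length (map initialBin shifted)) _ ⟩
          fromℕ (length (map initialBin shifted)) + fromℕ (nonemptyBins I c)
            ≡⟨ cong₂ (λ a j → fromℕ a + fromℕ (nonemptyBins I (configuration σ I j u))) (length-map initialBin shifted) (sym (#arrived≡n 0≤u)) ⟩
          fromℕ (count (moved? 0# u)) + fromℕ (activeBins σ I u)
            ≤⟨ +-monoˡ-≤ _ (subst (_≤ K * migratedSize e) K*shift≡ (*-monoʳ-≤ (proj₁ 0<K) (migration x∈ e ℕ.z≤n 0≤u u<μ))) ⟩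
          K * migratedSize e + fromℕ (activeBins σ I u) ∎
          where
          open ≤-R
          c = configuration σ I n u
          shifted = filter (moved? 0# u) (allFin n)
          K*shift≡ : K * sum (shift 0# u) ≡ fromℕ (count (moved? 0# u))
          K*shift≡ = trans (cong (K *_) (trans (sum-indicator (moved? 0# u) n id s) (trans (·≡fromℕ* (count (moved? 0# u)) s) (*-comm _ s))))
            (x*[x⁻¹*y]≡y _ 0<K)
          covered : map initialBin xs ⊆ map initialBin shifted ++ catMaybes (List.tabulate c)
          covered b∈ with ∈-map⁻ initialBin b∈
          ... | i , i∈ , refl with bin 0# i ℕₚ.≟ bin u i
          ...   | no  ≢ = ∈-++⁺ˡ (∈-map⁺ initialBin (∈-filter⁺ (moved? 0# u) (∈-allFin i) (i∈ , ≢)))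
          ...   | yes e = ∈-++⁺ʳ (map initialBin shifted) (∈-nonemptyBins c
            (trans (configuration-∈ 0≤u u<μ i∈) (cong just (trans (sym e) (bin-initial xs i)))))

        distinct*μ≤ : (a : StepFunction (activeBins σ I) 0#) →
          fromℕ (#distinct (map initialBin xs)) * μ ≤ ∫ a + K * migratedSize e * μ
        distinct*μ≤ a = begin
          D * μ                        ≡⟨ cong (_* μ) (m-n+n≡m D M) ⟨
          (D - M + M) * μ              ≡⟨ distribʳ μ (D - M) M ⟩
          (D - M) * μ + M * μ          ≤⟨ +-monoˡ-≤ (M * μ) (∫-lower a (D - M) μ (proj₁ 0<μ) bound) ⟩
          ∫ a + M * μ                  ∎
          where
          open ≤-R
          D = fromℕ (#distinct (map initialBin xs))
          M = K * migratedSize e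
          bound : ∀ u → 0# ≤ u → u < 0# + μ → D - M ≤ fromℕ (activeBins σ I u)
          bound u 0≤u u<μ = subst (D - M ≤_) ([m+n]-m≡n M _) (+-monoˡ-≤ (- M) (distinct≤ 0≤u (subst (u <_) (+-identityˡ μ) u<μ)))

      cost≤ : ∀ xs (a : StepFunction (activeBins σ (inst xs)) 0#) → ∫ a ≤ fromℕ n * μ
      cost≤ xs a = ∫-upper a n μ (proj₁ 0<μ) (Survivors.activeBins≤n xs) (Survivors.activeBins-over xs)

  -- Averaging over all draws

  sumOver : {A : Set} → List A → (A → ℝ) → ℝ
  sumOver xs g = foldr (λ x acc → g x + acc) 0# xs

  exceeds-average : {A : Set} (xs : List A) (g : A → ℝ) (c : ℝ) → fromℕ (length xs) * c < sumOver xs g → ∃[ x ] c < g x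
  exceeds-average []       g c (_ , ≢) = contradiction (zeroˡ c) ≢
  exceeds-average (x ∷ xs) g c < with c <? g x
  ... | yes c<gx = x , c<gx
  ... | no  c≮gx = exceeds-average xs g c (+-cancelʳ-< c (begin-strict
    fromℕ (length xs) * c + c          ≡⟨ solve 2 (λ l c → l :* c :+ c := (con 1 :+ l) :* c) refl (fromℕ (length xs)) c ⟩
    (1# + fromℕ (length xs)) * c       <⟨ < ⟩
    g x + sumOver xs g                 ≤⟨ +-monoˡ-≤ _ (≮⇒≥ c≮gx) ⟩
    c + sumOver xs g                   ≡⟨ +-comm c _ ⟩
    sumOver xs g + c                   ∎))
    where open ≤-R

  searchDown-≤ : ∀ {x} → 0# ≤ x → ∀ m → fromℕ (searchDown x m) ≤ x
  searchDown-≤ 0≤x zero = 0≤x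
  searchDown-≤ {x} 0≤x (suc m) with fromℕ (suc m) ≤? x
  ... | yes ≤x = ≤x
  ... | no  _  = searchDown-≤ 0≤x m

  module LowerBound (A : RandomizedAlgorithm) (k′ : ℕ) where
    open RandomizedAlgorithm A
    open Probability space
    k : ℕ
    -- The successor form lets the `NonZero` instance be found.
    k = suc k′
    open Adversary k public

    costExpectation : ∀ xs → ∃[ e ] HasExpectation (cost (inst xs)) e
    costExpectation xs = expectation-exists (cost (inst xs)) (fromℕ n * μ)
      (λ ω → ∫-nonneg (active ω (inst xs))) (λ ω → Run.cost≤ (strategy ω) xs (active ω (inst xs)))

    0≤costExpectation : ∀ xs → 0# ≤ proj₁ (costExpectation xs)
    0≤costExpectation xs = subst (_≤ proj₁ (costExpectation xs)) (trans (+-identityʳ _) (zeroˡ _))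
      (proj₁ (proj₂ (costExpectation xs)) _ (zeroFunction , (λ ω → ∫-nonneg (active ω (inst xs))) , refl))

    0<OPT : 0# < OPT
    0<OPT = fromℕ-mono-< {0} {k ℕ.+ n} (ℕ.s≤s ℕ.z≤n)

    module _ (α : ℝ) (migrationBound : ExpectedMigrationAtMost α A) (4αK≤1 : fromℕ 4 * α * K ≤ 1#) where

      Sequence : Set
      Sequence = Vec (Fin n) k

      I : Sequence → Instance
      I v = inst (toList v)

      costE migE : Sequence → ℝ
      costE v = proj₁ (costExpectation (toList v))
      migE v = proj₁ (migrationBound (I v))

      4migE≤1 : ∀ v → fromℕ 4 * migE v ≤ 1#
      4migE≤1 v = ≤-trans (*-monoʳ-≤ (0≤fromℕ 4) (proj₂ (proj₂ (migrationBound (I v)))))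
        (subst (_≤ 1#) (trans (*-assoc (fromℕ 4) α K) (cong (λ x → fromℕ 4 * (α * x)) (sym (totalSize≡K (toList v))))) 4αK≤1)

      0<4 : 0# < fromℕ 4
      0<4 = fromℕ-mono-< {0} {4} (ℕ.s≤s ℕ.z≤n)

      -- The weights are the coefficients in `4 D μ ≤ 4 cost + 4 K μ migrated`, where `D` counts the
      -- initial bins of the drawn items; the factor 4 clears denominators.
      costTerm migrationTerm : Sequence → Term
      costTerm v = record
        { weight = fromℕ 4 ; 0<weight = 0<4
        ; randomVariable = cost (I v) ; isRandomVariable = cost-measurable (I v)
        ; 0≤randomVariable = λ ω → ∫-nonneg (active ω (I v))
        ; expectation = costE v ; hasExpectation = proj₂ (costExpectation (toList v)) }
      migrationTerm v = record
        { weight = fromℕ 4 * (K * μ) ; 0<weight = *-pos 0<4 (*-pos 0<K 0<μ)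
        ; randomVariable = migrated (I v) ; isRandomVariable = migrated-measurable (I v)
        ; 0≤randomVariable = λ ω → Run.Survivors.migratedSize-nonneg (strategy ω) (toList v) (execution ω (I v))
        ; expectation = migE v ; hasExpectation = proj₁ (proj₂ (migrationBound (I v))) }

      terms : List Sequence → List Term
      terms []       = []
      terms (v ∷ vs) = costTerm v ∷ migrationTerm v ∷ terms vs

      distinct : Ω → Sequence → ℕ
      distinct ω v = #distinct (List.map (Run.initialBin (strategy ω)) (toList v))

      distinct≤cost+migration : ∀ ω v →
        fromℕ (distinct ω v) * μ ≤ cost (I v) ω + K * migrated (I v) ω * μ
      distinct≤cost+migration ω v@(x ∷ v′) =
        Run.distinct*μ≤ (strategy ω) (toList v) (here refl) (execution ω (I v)) (active ω (I v))

      weightedSum-terms : ∀ ω vs → fromℕ 4 * (fromℕ (∑ vs (distinct ω)) * μ) ≤ weightedSum (terms vs) ω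
      weightedSum-terms ω []       = ≤-reflexive (trans (cong (fromℕ 4 *_) (zeroˡ μ)) (zeroʳ _))
      weightedSum-terms ω (v ∷ vs) = begin
        fromℕ 4 * (fromℕ (distinct ω v ℕ.+ ∑ vs (distinct ω)) * μ)
          ≡⟨ cong (λ x → fromℕ 4 * (x * μ)) (fromℕ-+ (distinct ω v) _) ⟩
        fromℕ 4 * ((fromℕ (distinct ω v) + fromℕ (∑ vs (distinct ω))) * μ)
          ≡⟨ solve 4 (λ f d r m → f :* ((d :+ r) :* m) := f :* (d :* m) :+ f :* (r :* m)) refl
               (fromℕ 4) (fromℕ (distinct ω v)) (fromℕ (∑ vs (distinct ω))) μ ⟩
        fromℕ 4 * (fromℕ (distinct ω v) * μ) + fromℕ 4 * (fromℕ (∑ vs (distinct ω)) * μ)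
          ≤⟨ +-mono-≤ (*-monoʳ-≤ (0≤fromℕ 4) (distinct≤cost+migration ω v)) (weightedSum-terms ω vs) ⟩
        fromℕ 4 * (cost (I v) ω + K * migrated (I v) ω * μ) + weightedSum (terms vs) ω
          ≡⟨ solve 6 (λ f c κ g m r → f :* (c :+ κ :* g :* m) :+ r := f :* c :+ (f :* (κ :* m) :* g :+ r)) refl
               (fromℕ 4) (cost (I v) ω) K (migrated (I v) ω) μ (weightedSum (terms vs) ω) ⟩
        weightedSum (terms (v ∷ vs)) ω ∎
        where open ≤-R

      weightedExpectation-terms : ∀ vs → weightedExpectation (terms vs) ≤
        sumOver vs (λ v → fromℕ 4 * costE v) + fromℕ (length vs) * (K * μ)
      weightedExpectation-terms []       = ≤-reflexive (sym (trans (+-identityˡ _) (zeroˡ _)))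
      weightedExpectation-terms (v ∷ vs) = begin
        fromℕ 4 * costE v + (fromℕ 4 * (K * μ) * migE v + weightedExpectation (terms vs))
          ≤⟨ +-monoʳ-≤ _ (+-mono-≤ migration≤ (weightedExpectation-terms vs)) ⟩
        fromℕ 4 * costE v + (K * μ + (sumOver vs (λ v → fromℕ 4 * costE v) + fromℕ (length vs) * (K * μ)))
          ≡⟨ solve 4 (λ a x b l → a :+ (x :+ (b :+ l :* x)) := (a :+ b) :+ (con 1 :+ l) :* x) refl
               (fromℕ 4 * costE v) (K * μ) (sumOver vs (λ v → fromℕ 4 * costE v)) (fromℕ (length vs)) ⟩
        (fromℕ 4 * costE v + sumOver vs (λ v → fromℕ 4 * costE v)) + (1# + fromℕ (length vs)) * (K * μ) ∎
        where
        open ≤-R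
        migration≤ : fromℕ 4 * (K * μ) * migE v ≤ K * μ
        migration≤ = begin
          fromℕ 4 * (K * μ) * migE v   ≡⟨ solve 3 (λ f x m → f :* x :* m := x :* (f :* m)) refl (fromℕ 4) (K * μ) (migE v) ⟩
          K * μ * (fromℕ 4 * migE v)   ≤⟨ *-monoʳ-≤ (*-nonneg (proj₁ 0<K) (proj₁ 0<μ)) (4migE≤1 v) ⟩
          K * μ * 1#                   ≡⟨ *-identityʳ _ ⟩
          K * μ                        ∎

      allSequences : List Sequence
      allSequences = sequences (allFin n) k

      N : ℕ
      N = length allSequences

      length-allFin : length (allFin n) ≡ k ℕ.* k
      length-allFin = length-tabulate {n = n} id

      1≤N : 1 ℕ.≤ N
      1≤N = 1≤length-sequences (allFin n) (subst (1 ℕ.≤_) (sym length-allFin) (ℕ.s≤s ℕ.z≤n)) k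

      totalDistinct≥ : ∀ ω → (k ℕ.+ 1) ℕ.* N ℕ.≤ 2 ℕ.* ∑ allSequences (distinct ω)
      totalDistinct≥ ω = Fibres.totalDistinct-half (allFin n) (Run.initialBin (strategy ω)) k
        (Run.initialBin-fibre (strategy ω) (feasible ω)) length-allFin

      -- This is `4 μ` times the `(k + 1) N / 2` distinct bins guaranteed over all draws, a number
      -- independent of the outcome.
      C : ℝ
      C = fromℕ (2 ℕ.* (k ℕ.+ 1) ℕ.* N ℕ.* suc n)

      C≤weightedSum : ∀ ω → C ≤ weightedSum (terms allSequences) ω
      C≤weightedSum ω = ≤-trans (subst (C ≤_) eq (fromℕ-mono-≤ (ℕₚ.*-monoˡ-≤ (suc n) (begin
        2 ℕ.* (k ℕ.+ 1) ℕ.* N        ≡⟨ ℕₚ.*-assoc 2 (k ℕ.+ 1) N ⟩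
        2 ℕ.* ((k ℕ.+ 1) ℕ.* N)      ≤⟨ ℕₚ.*-monoʳ-≤ 2 (totalDistinct≥ ω) ⟩
        2 ℕ.* (2 ℕ.* T)              ≡⟨ ℕₚ.*-assoc 2 2 T ⟨
        4 ℕ.* T                      ∎)))) (weightedSum-terms ω allSequences)
        where
        open ℕₚ.≤-Reasoning
        T = ∑ allSequences (distinct ω)
        eq : fromℕ (4 ℕ.* T ℕ.* suc n) ≡ fromℕ 4 * (fromℕ T * μ)
        eq = trans (fromℕ-* (4 ℕ.* T) (suc n)) (trans (cong (_* μ) (fromℕ-* 4 T)) (*-assoc _ _ μ))

      -- The allowance `N * (K * μ)` for migration is added to both sides instead of being
      -- subtracted. It suffices because `4 * migE v ≤ 1`.
      average : fromℕ N * (K * OPT) < sumOver allSequences (λ v → fromℕ 4 * costE v)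
      average = +-cancelʳ-< (fromℕ N * (K * μ)) (begin-strict
        fromℕ N * (K * OPT) + fromℕ N * (K * μ)   ≡⟨ eq ⟨
        fromℕ (N ℕ.* (k ℕ.* (k ℕ.+ n)) ℕ.+ N ℕ.* (k ℕ.* suc n))  <⟨ fromℕ-mono-< (survivor-phase-dominates 1≤N k) ⟩
        C                                         ≤⟨ weightedExpectation-lower (terms allSequences) C C≤weightedSum ⟩
        weightedExpectation (terms allSequences)  ≤⟨ weightedExpectation-terms allSequences ⟩
        sumOver allSequences (λ v → fromℕ 4 * costE v) + fromℕ N * (K * μ) ∎)
        where
        open ≤-R
        product : ∀ a → fromℕ (N ℕ.* (k ℕ.* a)) ≡ fromℕ N * (K * fromℕ a)
        product a = trans (fromℕ-* N (k ℕ.* a)) (cong (fromℕ N *_) (fromℕ-* k a))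
        eq : fromℕ (N ℕ.* (k ℕ.* (k ℕ.+ n)) ℕ.+ N ℕ.* (k ℕ.* suc n)) ≡ fromℕ N * (K * OPT) + fromℕ N * (K * μ)
        eq = trans (fromℕ-+ (N ℕ.* (k ℕ.* (k ℕ.+ n))) _) (cong₂ _+_ (product (k ℕ.+ n)) (product (suc n)))

      competitive : CompetitiveRatioAtLeast (fromℕ 4 ⁻¹ * K) A
      competitive β β<γ = witness (exceeds-average allSequences (λ v → fromℕ 4 * costE v) (K * OPT) average)
        where
        open ≤-R
        witness : (∃[ v ] K * OPT < fromℕ 4 * costE v) →
          ∃[ J ] ∃[ opt ] ∃[ e ] IsOPT J opt × HasExpectation (cost J) e × β * opt < e
        witness (v@(x ∷ v′) , K*OPT<) = I v , OPT , costE v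
          , isOPT x (toList v′) (ℕₚ.≤-reflexive (Vecₚ.length-toList v))
          , proj₂ (costExpectation (toList v))
          , *-cancelˡ-< 0<4 (begin-strict
              fromℕ 4 * (β * OPT)              ≡⟨ solve 3 (λ f b o → f :* (b :* o) := o :* (f :* b)) refl (fromℕ 4) β OPT ⟩
              OPT * (fromℕ 4 * β)              <⟨ *-monoʳ-< 0<OPT (*-monoʳ-< 0<4 β<γ) ⟩
              OPT * (fromℕ 4 * (fromℕ 4 ⁻¹ * K))  ≡⟨ cong (OPT *_) (x*[x⁻¹*y]≡y K 0<4) ⟩
              OPT * K                          ≡⟨ *-comm OPT K ⟩
              K * OPT                          <⟨ K*OPT< ⟩
              fromℕ 4 * costE v                ∎)

  -- Here `β` is negative while costs are nonnegative, so any instance with positive optimum is a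
  -- witness; the one-item instance for `k = 1` is taken.
  competitive-0 : ∀ A → CompetitiveRatioAtLeast (fromℕ 4 ⁻¹ * fromℕ 0) A
  competitive-0 A β β<γ = inst (Fin.zero ∷ []) , OPT , proj₁ (costExpectation (Fin.zero ∷ []))
    , isOPT Fin.zero [] ℕₚ.≤-refl , proj₂ (costExpectation (Fin.zero ∷ []))
    , <-≤-trans (subst₂ _<_ (*-comm OPT β) (zeroʳ OPT) (*-monoʳ-< 0<OPT (subst (β <_) (zeroʳ (fromℕ 4 ⁻¹)) β<γ)))
        (0≤costExpectation (Fin.zero ∷ []))
    where open LowerBound A 0

theorem23 : (R : RealNumbers) → let open RealNumbers R in let open BinPacking R in
    ∀ (α : ℝ) → 0# < α → α < 1# →
    (A : RandomizedAlgorithm) → ExpectedMigrationAtMost α A →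
    CompetitiveRatioAtLeast ((fromℕ 4) ⁻¹ * fromℕ ⌊ (fromℕ 4 * α) ⁻¹ ⌋) A
theorem23 R α 0<α _ A migrationBound = bound ⌊ x ⌋ (searchDown-≤ (proj₁ (0<⁻¹ 0<4α)) (proj₁ (archimedean x)))
  where
  open RealNumbers R
  open BinPacking R
  open OrderedField R
  open LowerBounds R
  0<4α : 0# < fromℕ 4 * α
  0<4α = *-pos (fromℕ-mono-< {0} {4} (ℕ.s≤s ℕ.z≤n)) 0<α
  x : ℝ
  x = (fromℕ 4 * α) ⁻¹
  -- The floor is zero when `α` exceeds 1/4, whereas the adversary needs `k ≥ 1`; otherwise `m ≤ x`
  -- times `4 α` is the hypothesis `4 α k ≤ 1`.
  bound : ∀ m → fromℕ m ≤ x → CompetitiveRatioAtLeast ((fromℕ 4) ⁻¹ * fromℕ m) A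
  bound zero     _   = competitive-0 A
  bound (suc k′) m≤x = LowerBound.competitive A k′ α migrationBound
    (subst (fromℕ 4 * α * fromℕ (suc k′) ≤_) (trans (*-comm (fromℕ 4 * α) x) (*-inverseˡ 0<4α)) (*-monoʳ-≤ (proj₁ 0<4α) m≤x))
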